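{- Let $d\in\mathbb{N}$, $D_E^{\mathrm{s}}=D_V^{\mathrm{s}}=\mathrm{Vect}(\mathbb{N}^{d+1})$, $\lambda\in\mathbb{K}^{d+1}$, and let $\phi^\lambda$ be the endomorphism of $D_E^{\mathrm{s}}\otimes D_V^{\mathrm{s}}$ given by $\phi^\lambda(a\otimes b)=\sum_{l\leq\min(a,b)}\lambda^l\binom{b}{l}(a-l)\otimes(b-l)$ for $a,b\in\mathbb{N}^{d+1}$. Then the $D_E^{\mathrm{s}}$-multiple pre-Lie algebra $(\mathcal{T}(D_E^{\mathrm{s}},D_V^{\mathrm{s}}),\triangleleft^{\phi^\lambda})$ is freely generated by the one-vertex trees $\bullet\otimes b$, $b\in D_V^{\mathrm{s}}$. Moreover $\Theta_{\phi^\lambda}$ is an isomorphism from $(\mathcal{T}(D_E^{\mathrm{s}},D_V^{\mathrm{s}}),\triangleleft)$ to $(\mathcal{T}(D_E^{\mathrm{s}},D_V^{\mathrm{s}}),\triangleleft^{\phi^\lambda})$, with inverse $\Theta_{\phi^{ -\lambda}}$.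
   Context: $\mathbb{K}$ is a field of characteristic zero. Notation: $l\leq b$ and $\min$ are componentwise on $\mathbb{N}^{d+1}$, $\binom{b}{l}=\prod_i\binom{b_i}{l_i}$, $\lambda^l=\prod_i\lambda_i^{l_i}$ ($0^0=1$). For vector spaces $D_E,D_V$: rooted trees are finite non-planar, edges oriented from root to leaves with source $s(e)$ (endpoint nearer the root); $\mathcal{T}(D_E,D_V)=\bigoplus_T\bigl(\bigotimes_{e\in E(T)}D_E\otimes\bigotimes_{v\in V(T)}D_V\bigr)$, elements $T\otimes W_T$ with $W_T$ the tensor of edge and vertex decorations. For linear $\phi$ on $D_E\otimes D_V$, $\phi_{e,v}$ applies $\phi$ to the decorations of edge $e$ and vertex $v$. $\phi$ is tree-compatible if $\phi_{13}\phi_{23}=\phi_{23}\phi_{13}$ on $D_E\otimes D_E\otimes D_V$, where $\phi_{23}=\mathrm{Id}\otimes\phi$, $\phi_{13}=(\tau\otimes\mathrm{Id})(\mathrm{Id}\otimes\phi)(\tau\otimes\mathrm{Id})$ ($\tau$ flip). For tree-compatible $\phi$, $\Theta_\phi$ acts on $T\otimes W_T$ by applying the composite of all $\phi_{e,s(e)}$, $e\in E(T)$ (order irrelevant) to $W_T$. For $v\in V(T')$, $T\curvearrowright_vT'$ adds an edge from $v$ to the root of $T$; $(T\otimes W_T)\triangleleft^\phi_a(T'\otimes W_{T'})=\sum_{v\in V(T')}T\curvearrowright_vT'\otimes\phi_{e_{\mathrm{new}},v}(a\otimes W_T\otimes W_{T'})$ with $a$ decorating the new edge; $\triangleleft=\triangleleft^{\mathrm{Id}}$.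 A $D_E$-multiple pre-Lie algebra is a space with products $\triangleleft_a$ linear in $a\in D_E$ satisfying $x\triangleleft_a(y\triangleleft_{a'}z)-(x\triangleleft_a y)\triangleleft_{a'}z=y\triangleleft_{a'}(x\triangleleft_a z)-(y\triangleleft_{a'}x)\triangleleft_a z$. "Freely generated by $\bullet\otimes b$" means every linear map from $D_V$ to a $D_E$-multiple pre-Lie algebra extends uniquely to a morphism sending $\bullet\otimes b\mapsto f(b)$. -}

module Defs where

open import Level using (Level; _⊔_) renaming (suc to lsuc)
open import Algebra.Bundles using (CommutativeRing)
open import Algebra.Module.Bundles using (Module)
open import Data.Nat as ℕ using (ℕ; zero; suc)
open import Data.Nat.Combinatorics using (_C_)
open import Data.Vec as Vec using (Vec; []; _∷_)
open import Data.List as List using (List; []; _∷_; _++_; [_])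
open import Data.Product using (Σ; _×_; _,_; proj₁; proj₂)
open import Relation.Nullary using (¬_)
open import Relation.Binary.PropositionalEquality using (_≡_)

record Field (c ℓ : Level) : Set (lsuc (c ⊔ ℓ)) where
  field
    commutativeRing : CommutativeRing c ℓ
  open CommutativeRing commutativeRing public
  field
    1≉0     : ¬ (1# ≈ 0#)
    inverse : ∀ x → ¬ (x ≈ 0#) → Σ Carrier λ y → (x * y) ≈ 1#

module _ {c ℓ : Level} (K : Field c ℓ) where
  open Field K

  natK : ℕ → Carrier
  natK zero    = 0#
  natK (suc n) = 1# + natK n

  CharZero : Set ℓ
  CharZero = ∀ n → ¬ (natK (suc n) ≈ 0#)

  powK : Carrier → ℕ → Carrier
  powK x zero    = 1#
  powK x (suc n) = x * powK x n

  -- The free K-vector space Vect(X) on a set X whose elements are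
  -- identified by an equivalence R: formal finite linear combinations
  -- (lists of coefficient/basis pairs) modulo the relations of the free
  -- vector space on X/R.

  Lin : Set → Set c
  Lin X = List (Carrier × X)

  data LinEq {X : Set} (R : X → X → Set) : Lin X → Lin X → Set (c ⊔ ℓ) where
    lrefl  : ∀ {xs} → LinEq R xs xs
    lsym   : ∀ {xs ys} → LinEq R xs ys → LinEq R ys xs
    ltrans : ∀ {xs ys zs} → LinEq R xs ys → LinEq R ys zs → LinEq R xs zs
    lapp   : ∀ {xs xs' ys ys'} → LinEq R xs xs' → LinEq R ys ys' →
             LinEq R (xs ++ ys) (xs' ++ ys')
    lswap  : ∀ {xs ys} → LinEq R (xs ++ ys) (ys ++ xs)
    lmerge : ∀ {a b x} → LinEq R ((a , x) ∷ (b , x) ∷ []) [ (a + b , x) ]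
    lzero  : ∀ {x} → LinEq R [ (0# , x) ] []
    lcoef  : ∀ {a b x} → a ≈ b → LinEq R [ (a , x) ] [ (b , x) ]
    lbasis : ∀ {a x y} → R x y → LinEq R [ (a , x) ] [ (a , y) ]

  single : {X : Set} → X → Lin X
  single x = [ (1# , x) ]

  scale : {X : Set} → Carrier → Lin X → Lin X
  scale k = List.map (λ p → (k * proj₁ p , proj₂ p))

  bind : {X Y : Set} → (X → Lin Y) → Lin X → Lin Y
  bind f = List.concatMap (λ p → scale (proj₁ p) (f (proj₂ p)))

  linMap : {X Y : Set} → (X → Y) → Lin X → Lin Y
  linMap f = bind (λ x → single (f x))

  bind2 : {X Y Z : Set} → (X → Y → Lin Z) → Lin X → Lin Y → Lin Z
  bind2 f xs ys = bind (λ x → bind (λ y → f x y) ys) xs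

  record IsLinear {m ℓm : Level} {X : Set} (R : X → X → Set)
                  (M : Module commutativeRing m ℓm)
                  (g : Lin X → Module.Carrierᴹ M) : Set (c ⊔ ℓ ⊔ m ⊔ ℓm) where
    open Module M
    field
      cong  : ∀ {xs ys} → LinEq R xs ys → g xs ≈ᴹ g ys
      additive : ∀ xs ys → g (xs ++ ys) ≈ᴹ (g xs +ᴹ g ys)
      homogeneous : ∀ k xs → g (scale k xs) ≈ᴹ (k *ₗ g xs)

  record IsEndo {m ℓm : Level} (M : Module commutativeRing m ℓm)
                (g : Module.Carrierᴹ M → Module.Carrierᴹ M) : Set (c ⊔ m ⊔ ℓm) where
    open Module M
    field
      cong  : ∀ {x y} → x ≈ᴹ y → g x ≈ᴹ g y
      additive : ∀ x y → g (x +ᴹ y) ≈ᴹ (g x +ᴹ g y)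
      homogeneous : ∀ k x → g (k *ₗ x) ≈ᴹ (k *ₗ g x)

  module _ (d : ℕ) where

    -- multi-indices ℕ^{d+1}; D_E^s = D_V^s = Vect(ℕ^{d+1}) = Lin (NI d)

    NI : Set
    NI = Vec ℕ (suc d)

    -- Rooted trees with edges and vertices decorated by basis elements
    -- of D_E^s, D_V^s.  A tree is a root with its vertex decoration and
    -- a list of (decoration of the edge to the child, child subtree).
    -- Planar representatives; non-planarity is the isomorphism _≅_.

    data Tree : Set where
      node : NI → List (NI × Tree) → Tree

    mutual
      data _≅_ : Tree → Tree → Set where
        node≅ : ∀ {b b' cs cs'} → b ≡ b' → ChildrenIso cs cs' →
                node b cs ≅ node b' cs'

      data ChildrenIso : List (NI × Tree) → List (NI × Tree) → Set where
        nil  : ChildrenIso [] []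
        cons : ∀ {a a' t t' cs ds ds'} → a ≡ a' → t ≅ t' →
               ChildrenIso cs (ds ++ ds') →
               ChildrenIso ((a , t) ∷ cs) (ds ++ ((a' , t') ∷ ds'))

    𝒯 : Set c
    𝒯 = Lin Tree

    _≈𝒯_ : 𝒯 → 𝒯 → Set (c ⊔ ℓ)
    _≈𝒯_ = LinEq _≅_

    dot : Lin NI → 𝒯
    dot = linMap (λ b → node b [])

    -- linear endomorphisms φ of D_E ⊗ D_V, given on the basis a ⊗ b

    Endo : Set c
    Endo = NI × NI → Lin (NI × NI)

    idφ : Endo
    idφ = single

    box : ∀ {k} → Vec ℕ k → List (Vec ℕ k)
    box []       = [ [] ]
    box (m ∷ ms) = List.concatMap (λ i → List.map (i ∷_) (box ms)) (List.upTo (suc m))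

    minᵥ : NI → NI → NI
    minᵥ = Vec.zipWith ℕ._⊓_

    subᵥ : NI → NI → NI
    subᵥ = Vec.zipWith ℕ._∸_

    binomᵥ : NI → NI → Carrier
    binomᵥ b l = natK (Vec.foldr _ ℕ._*_ 1 (Vec.zipWith _C_ b l))

    powᵥ : Vec Carrier (suc d) → NI → Carrier
    powᵥ λ' l = Vec.foldr _ _*_ 1# (Vec.zipWith powK λ' l)

    φ^ : Vec Carrier (suc d) → Endo
    φ^ λ' (a , b) =
      List.map (λ l → (powᵥ λ' l * binomᵥ b l , (subᵥ a l , subᵥ b l)))
               (box (minᵥ a b))

    -- grafting product  T ◁^φ_a T'  on basis elements: sum over vertices
    -- v of T' of T ↷_v T' with φ applied to (new edge, v).

    mutual
      graft : Endo → NI → Tree → Tree → 𝒯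
      graft φ a t (node b cs) =
        List.map (λ p → (proj₁ p , node (proj₂ (proj₂ p)) ((proj₁ (proj₂ p) , t) ∷ cs)))
                 (φ (a , b))
        ++ graftCh φ a t b [] cs

      graftCh : Endo → NI → Tree → NI → List (NI × Tree) → List (NI × Tree) → 𝒯
      graftCh φ a t b done [] = []
      graftCh φ a t b done ((e , s) ∷ rest) =
        List.map (λ p → (proj₁ p , node b (done ++ ((e , proj₂ p) ∷ rest))))
                 (graft φ a t s)
        ++ graftCh φ a t b (done ++ [ (e , s) ]) rest

    ◁[_] : Endo → 𝒯 → Lin NI → 𝒯 → 𝒯
    ◁[ φ ] x as y = bind (λ a → bind2 (graft φ a) x y) as

    ◁₀ : 𝒯 → Lin NI → 𝒯 → 𝒯
    ◁₀ = ◁[ idφ ]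

    -- Θ_φ: apply φ_{e,s(e)} for every edge e.  At a vertex with
    -- decoration b and outgoing edges a₁..aₖ, φ is applied successively
    -- to (a₁,b), (a₂,b'), ...; subtrees are treated recursively.

    rootPart : Endo → NI → List NI → Lin (NI × List NI)
    rootPart φ b []       = single (b , [])
    rootPart φ b (a ∷ as) =
      bind (λ p → linMap (λ q → (proj₁ q , proj₁ p ∷ proj₂ q)) (rootPart φ (proj₂ p) as))
           (φ (a , b))

    mutual
      θ : Endo → Tree → 𝒯
      θ φ (node b cs) =
        bind2 (λ p ts → single (node (proj₁ p) (List.zip (proj₂ p) ts)))
              (rootPart φ b (List.map proj₁ cs)) (θs φ cs)

      θs : Endo → List (NI × Tree) → Lin (List Tree)
      θs φ []             = single []
      θs φ ((e , s) ∷ cs) = bind2 (λ s' ts → single (s' ∷ ts)) (θ φ s) (θs φ cs)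

    Θ : Endo → 𝒯 → 𝒯
    Θ φ = bind (θ φ)

    record MultiplePreLie (m ℓm : Level) : Set (lsuc (m ⊔ ℓm) ⊔ c ⊔ ℓ) where
      field
        module' : Module commutativeRing m ℓm
      open Module module' public
      field
        _◁⟨_⟩_ : Carrierᴹ → Lin NI → Carrierᴹ → Carrierᴹ
        linear-a : ∀ x y → IsLinear _≡_ module' (λ a → x ◁⟨ a ⟩ y)
        linear-l : ∀ a y → IsEndo module' (λ x → x ◁⟨ a ⟩ y)
        linear-r : ∀ a x → IsEndo module' (λ y → x ◁⟨ a ⟩ y)
        pre-Lie : ∀ a a' x y z →
          ((x ◁⟨ a ⟩ (y ◁⟨ a' ⟩ z)) +ᴹ (-ᴹ ((x ◁⟨ a ⟩ y) ◁⟨ a' ⟩ z))) ≈ᴹ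
          ((y ◁⟨ a' ⟩ (x ◁⟨ a ⟩ z)) +ᴹ (-ᴹ ((y ◁⟨ a' ⟩ x) ◁⟨ a ⟩ z)))

    record IsMorphism {m ℓm : Level} (φ : Endo) (A : MultiplePreLie m ℓm)
                      (F : 𝒯 → MultiplePreLie.Carrierᴹ A) : Set (c ⊔ ℓ ⊔ m ⊔ ℓm) where
      open MultiplePreLie A
      field
        linear : IsLinear _≅_ module' F
        preserves : ∀ a x y → F (◁[ φ ] x a y) ≈ᴹ (F x ◁⟨ a ⟩ F y)

    record IsMultiplePreLie𝒯 (φ : Endo) : Set (c ⊔ ℓ) where
      field
        cong : ∀ {a a' x x' y y'} → LinEq _≡_ a a' → x ≈𝒯 x' → y ≈𝒯 y' →
               ◁[ φ ] x a y ≈𝒯 ◁[ φ ] x' a' y'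
        pre-Lie : ∀ a a' x y z →
          (◁[ φ ] x a (◁[ φ ] y a' z) ++ scale (- 1#) (◁[ φ ] (◁[ φ ] x a y) a' z)) ≈𝒯
          (◁[ φ ] y a' (◁[ φ ] x a z) ++ scale (- 1#) (◁[ φ ] (◁[ φ ] y a' x) a z))

    FreelyGenerated : (m ℓm : Level) → Endo → Set (lsuc (m ⊔ ℓm) ⊔ c ⊔ ℓ)
    FreelyGenerated m ℓm φ =
      (A : MultiplePreLie m ℓm) →
      let open MultiplePreLie A in
      (f : Lin NI → Carrierᴹ) → IsLinear _≡_ module' f →
      Σ (𝒯 → Carrierᴹ) λ F →
        IsMorphism φ A F ×
        (∀ b → F (dot b) ≈ᴹ f b) ×
        (∀ G → IsMorphism φ A G → (∀ b → G (dot b) ≈ᴹ f b) → ∀ x → G x ≈ᴹ F x)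

    record IsIsoWithInverse (φ ψ : Endo) : Set (c ⊔ ℓ) where
      field
        cong     : ∀ {x y} → x ≈𝒯 y → Θ φ x ≈𝒯 Θ φ y
        cong⁻¹   : ∀ {x y} → x ≈𝒯 y → Θ ψ x ≈𝒯 Θ ψ y
        additive : ∀ x y → Θ φ (x ++ y) ≈𝒯 (Θ φ x ++ Θ φ y)
        homogeneous : ∀ k x → Θ φ (scale k x) ≈𝒯 scale k (Θ φ x)
        morphism : ∀ a x y → Θ φ (◁₀ x a y) ≈𝒯 ◁[ φ ] (Θ φ x) a (Θ φ y)
        left-inv  : ∀ x → Θ ψ (Θ φ x) ≈𝒯 x
        right-inv : ∀ x → Θ φ (Θ ψ x) ≈𝒯 x

-- Write N_φ(b; (a₁, y₁), …, (aₙ, yₙ)) for the trees y₁, …, yₙ attached to a root decorated by b, with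
-- φ applied successively to each new edge and the root decoration. Then Θ_φ sends a tree with root
-- decoration b and branches (aᵢ, tᵢ) to N_φ(b; (aᵢ, Θ_φ tᵢ)), and tree-compatibility of φ gives
--   x ◁_a N_φ(b; ys) = N_φ(b; (a, x), ys) + Σᵢ N_φ(b; …, (aᵢ, x ◁_a yᵢ), …).
-- By induction on trees this makes Θ_φ a morphism. It also proves the pre-Lie identity on the image of
-- Θ_φ: the terms grafting x and y at different places are symmetric since N_φ is, the others come from
-- the identity for the yᵢ. If φ and ψ are mutually inverse and compatible with one another, so that their
-- actions on different edges commute, then Θ_φ and Θ_ψ are mutually inverse.
--
-- For φ = Id, a morphism F into A with F(• ⊗ b) = f(b) has to satisfy the same recursion, which defines it
-- by symmetric multilinear braces in A; the pre-Lie identity of A is what makes them symmetric. Composing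
-- with Θ_ψ gives freeness for ◁^φ.
--
-- For φ^λ, compatibility and φ^{-λ} φ^λ = Id reduce to one coordinate, where Pascal's rule says
-- φ^λ S = (S + λ P) φ^λ for the shift S : b ↦ b + 1 and the lowering P : a ↦ a − 1 (0 if a = 0).

module Submission where

open import Defs
open import Level using (Level; _⊔_)
open import Algebra.Module.Bundles using (Module)
open import Algebra.Module.Structures.Biased using (IsModuleFromLeft)
open import Data.List using (List; []; _∷_; _++_; length; upTo; applyUpTo)
import Data.List as List
import Data.List.Properties as List
open import Data.List.Relation.Unary.All using (All; []; _∷_)
import Data.List.Relation.Unary.All as All
import Data.List.Relation.Unary.All.Properties as All
open import Data.Nat as ℕ using (ℕ; zero; suc; _∸_; _⊓_; _<_; s≤s; z≤n)
open import Data.Nat.Combinatorics using (_C_; nCk+nC[k+1]≡[n+1]C[k+1]; k>n⇒nCk≡0)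
open import Data.Product using (_×_; _,_; proj₁; proj₂; map₂)
open import Data.Vec as Vec using (Vec; []; _∷_; map)
open import Data.Vec.Relation.Binary.Pointwise.Inductive using (Pointwise; []; _∷_)
open import Function using (_∘_; id)
open import Relation.Binary.PropositionalEquality as ≡ using (_≡_)
import Relation.Binary.Reasoning.Setoid as SetoidReasoning
import Algebra.Properties.AbelianGroup as AbelianGroupProperties
import Algebra.Properties.CommutativeSemigroup as CommSemigroup
import Algebra.Solver.CommutativeMonoid as CommutativeMonoidSolver

-- Formal linear combinations

-- No tensor product is ever formed. A combination of basis tuples is seen only through its
-- evaluation against arbitrary functions `k` into a module, so compatibility, mutual inverseness
-- and N_φ itself (`gather`) become statements about iterated sums, and commuting operations on
-- distinct tensor factors becomes an exchange of summations.
--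
-- What shapes the pre-Lie argument is that for general φ a given tree is not visibly of the form
-- N_φ(b; ys): the action of φ on the edges at its root would first have to be undone. Hence the
-- induction runs over the values of `θ`, and an arbitrary z is reached only as Θ_φ(Θ_ψ z).
--
-- Trees are planar lists of branches, so every map has to be shown to respect isomorphism. `θ`
-- treats the edges at a vertex in list order, and compatibility makes that order irrelevant; for
-- the morphism into A the same role falls to the symmetry of the braces. Signs are mostly avoided:
-- pre-Lie identities are used with their negative terms moved to the other side.

module LinearAlgebra {c ℓ : Level} (K : Field c ℓ) where
  open Field K

  Mod : (m ℓm : Level) → Set _
  Mod = Module commutativeRing

  module _ {X : Set} (R : X → X → Set) where

    private
      _≋_ : Lin K X → Lin K X → Set _
      _≋_ = LinEq K R

    scale-cong : ∀ {k k′} {xs ys : Lin K X} → k ≈ k′ → xs ≋ ys → scale K k xs ≋ scale K k′ ys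
    scale-cong k≈ (lrefl {xs})         = go xs
      where
      go : ∀ xs → scale K _ xs ≋ scale K _ xs
      go []       = lrefl
      go (x ∷ xs) = lapp (lcoef (*-congʳ k≈)) (go xs)
    scale-cong k≈ (lsym e)             = lsym (scale-cong (sym k≈) e)
    scale-cong k≈ (ltrans e e′)        = ltrans (scale-cong refl e) (scale-cong k≈ e′)
    scale-cong {k} {k′} k≈ (lapp {xs} {xs′} {ys} {ys′} e e′)
      rewrite List.map-++ (λ p → (k * proj₁ p , proj₂ p)) xs ys
            | List.map-++ (λ p → (k′ * proj₁ p , proj₂ p)) xs′ ys′ =
      lapp (scale-cong k≈ e) (scale-cong k≈ e′)
    scale-cong {k} {k′} k≈ (lswap {xs} {ys})
      rewrite List.map-++ (λ p → (k * proj₁ p , proj₂ p)) xs ys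
            | List.map-++ (λ p → (k′ * proj₁ p , proj₂ p)) ys xs =
      ltrans (lswap {xs = scale K k xs}) (lapp {xs = scale K k ys} (scale-cong k≈ lrefl) (scale-cong k≈ lrefl))
    scale-cong k≈ lmerge               =
      ltrans lmerge (lcoef (trans (sym (distribˡ _ _ _)) (*-congʳ k≈)))
    scale-cong k≈ lzero                = ltrans (lcoef (zeroʳ _)) lzero
    scale-cong k≈ (lcoef e)            = lcoef (*-cong k≈ e)
    scale-cong k≈ (lbasis r)           = ltrans (lcoef (*-congʳ k≈)) (lbasis r)

    ≋-reflexive : ∀ {xs ys} → xs ≡ ys → xs ≋ ys
    ≋-reflexive ≡.refl = lrefl

    scale-distribʳ : ∀ xs k k′ → scale K (k + k′) xs ≋ (scale K k xs ++ scale K k′ xs)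
    scale-distribʳ []             k k′ = lrefl
    scale-distribʳ ((a , x) ∷ xs) k k′ =
      ltrans (lapp (ltrans (lcoef (distribʳ a k k′)) (lsym lmerge)) (scale-distribʳ xs k k′))
      (lapp {xs = (k * a , x) ∷ []} lrefl
        (ltrans (≋-reflexive (≡.sym (List.++-assoc ((k′ * a , x) ∷ []) (scale K k xs) _)))
        (ltrans (lapp (lswap {xs = (k′ * a , x) ∷ []} {ys = scale K k xs}) lrefl)
        (≋-reflexive (List.++-assoc (scale K k xs) _ _)))))

    scale-zero : ∀ xs → scale K 0# xs ≋ []
    scale-zero []       = lrefl
    scale-zero (x ∷ xs) = lapp (ltrans (lcoef (zeroˡ _)) lzero) (scale-zero xs)

    scale-one : ∀ xs → scale K 1# xs ≋ xs
    scale-one []       = lrefl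
    scale-one (x ∷ xs) = lapp (lcoef (*-identityˡ _)) (scale-one xs)

    scale-assoc : ∀ k k′ xs → scale K (k * k′) xs ≋ scale K k (scale K k′ xs)
    scale-assoc k k′ []       = lrefl
    scale-assoc k k′ (x ∷ xs) = lapp (lcoef (*-assoc _ _ _)) (scale-assoc k k′ xs)

    scale-inverseʳ : ∀ xs → (xs ++ scale K (- 1#) xs) ≋ []
    scale-inverseʳ xs =
      ltrans (lapp (lsym (scale-one xs)) lrefl)
      (ltrans (lsym (scale-distribʳ xs 1# (- 1#)))
      (ltrans (scale-cong (-‿inverseʳ 1#) lrefl) (scale-zero xs)))

    -- Gives formal combinations the same interface as the target A, so that one stock of lemmas on
    -- `eval` and `Linear` serves maps from 𝒯 to 𝒯 and from 𝒯 to A.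
    free : Mod c (c ⊔ ℓ)
    free = record
      { Carrierᴹ = Lin K X
      ; _≈ᴹ_ = _≋_
      ; _+ᴹ_ = _++_
      ; _*ₗ_ = scale K
      ; _*ᵣ_ = λ xs k → scale K k xs
      ; 0ᴹ = []
      ; -ᴹ_ = scale K (- 1#)
      ; isModule = IsModuleFromLeft.isModule record { isLeftModule = record
        { isLeftSemimodule = record
          { +ᴹ-isCommutativeMonoid = record
            { isMonoid = record
              { isSemigroup = record
                { isMagma = record
                  { isEquivalence = record { refl = lrefl ; sym = lsym ; trans = ltrans }
                  ; ∙-cong = lapp
                  }
                ; assoc = λ xs ys zs → ≋-reflexive (List.++-assoc xs ys zs)
                }
              ; identity = (λ _ → lrefl) , (λ xs → ≋-reflexive (List.++-identityʳ xs))
              }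
            ; comm = λ xs ys → lswap {xs = xs} {ys = ys}
            }
          ; isPreleftSemimodule = record
            { *ₗ-cong = scale-cong
            ; *ₗ-zeroˡ = scale-zero
            ; *ₗ-distribʳ = scale-distribʳ
            ; *ₗ-identityˡ = scale-one
            ; *ₗ-assoc = scale-assoc
            ; *ₗ-zeroʳ = λ _ → lrefl
            ; *ₗ-distribˡ = λ k xs ys → ≋-reflexive (List.map-++ _ xs ys)
            }
          }
        ; -ᴹ‿cong = scale-cong refl
        ; -ᴹ‿inverse = (λ xs → ltrans (lswap {xs = scale K (- 1#) xs}) (scale-inverseʳ xs))
                     , scale-inverseʳ
        } }
      }

  -- A common form of `IsLinear`, whose source is free, and `IsEndo`, whose source and target agree;
  -- composites stay inside one notion.
  record Linear {m ℓm n ℓn : Level} (M : Mod m ℓm) (N : Mod n ℓn)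
                (f : Module.Carrierᴹ M → Module.Carrierᴹ N) : Set (c ⊔ m ⊔ ℓm ⊔ n ⊔ ℓn) where
    private
      module M = Module M
      module N = Module N
    field
      cong   : ∀ {x y} → x M.≈ᴹ y → f x N.≈ᴹ f y
      +-homo : ∀ x y → f (x M.+ᴹ y) N.≈ᴹ (f x N.+ᴹ f y)
      *-homo : ∀ k x → f (k M.*ₗ x) N.≈ᴹ (k N.*ₗ f x)

    0-homo : f M.0ᴹ N.≈ᴹ N.0ᴹ
    0-homo = N.≈ᴹ-trans (cong (M.≈ᴹ-sym (M.*ₗ-zeroˡ M.0ᴹ)))
             (N.≈ᴹ-trans (*-homo 0# M.0ᴹ) (N.*ₗ-zeroˡ _))

  module _ {m ℓm : Level} (M : Mod m ℓm) where
    open Module M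

    -- Into a free module this is definitionally `bind`.
    eval : {X : Set} → (X → Carrierᴹ) → Lin K X → Carrierᴹ
    eval f xs = List.foldr _+ᴹ_ 0ᴹ (List.map (λ p → proj₁ p *ₗ f (proj₂ p)) xs)

    +-interchange : ∀ x y z w → (x +ᴹ y) +ᴹ (z +ᴹ w) ≈ᴹ (x +ᴹ z) +ᴹ (y +ᴹ w)
    +-interchange = CommSemigroup.interchange
      (record { isCommutativeSemigroup = record { isSemigroup = +ᴹ-isSemigroup ; comm = +ᴹ-comm } })

    open SetoidReasoning ≈ᴹ-setoid

    module _ {X : Set} where

      eval-cong : {f g : X → Carrierᴹ} → (∀ x → f x ≈ᴹ g x) → ∀ xs → eval f xs ≈ᴹ eval g xs
      eval-cong f≈g []       = ≈ᴹ-refl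
      eval-cong f≈g (x ∷ xs) = +ᴹ-cong (*ₗ-congˡ (f≈g _)) (eval-cong f≈g xs)

      eval-0 : ∀ xs → eval {X} (λ _ → 0ᴹ) xs ≈ᴹ 0ᴹ
      eval-0 []       = ≈ᴹ-refl
      eval-0 (x ∷ xs) = ≈ᴹ-trans (+ᴹ-cong (*ₗ-zeroʳ _) (eval-0 xs)) (+ᴹ-identityˡ _)

      eval-+ : (f g : X → Carrierᴹ) → ∀ xs →
               eval (λ x → f x +ᴹ g x) xs ≈ᴹ eval f xs +ᴹ eval g xs
      eval-+ f g []       = ≈ᴹ-sym (+ᴹ-identityˡ _)
      eval-+ f g (x ∷ xs) = ≈ᴹ-trans (+ᴹ-cong (*ₗ-distribˡ _ _ _) (eval-+ f g xs))
                                     (+-interchange _ _ _ _)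

      eval-* : ∀ k (f : X → Carrierᴹ) xs → eval (λ x → k *ₗ f x) xs ≈ᴹ k *ₗ eval f xs
      eval-* k f []             = ≈ᴹ-sym (*ₗ-zeroʳ k)
      eval-* k f ((a , x) ∷ xs) = begin
        a *ₗ (k *ₗ f x) +ᴹ eval (λ x → k *ₗ f x) xs ≈⟨ +ᴹ-cong (*ₗ-comm a k (f x)) (eval-* k f xs) ⟩
        k *ₗ (a *ₗ f x) +ᴹ k *ₗ eval f xs           ≈⟨ *ₗ-distribˡ k _ _ ⟨
        k *ₗ (a *ₗ f x +ᴹ eval f xs)                ∎

      module _ (f : X → Carrierᴹ) where

        eval-++ : ∀ xs ys → eval f (xs ++ ys) ≈ᴹ eval f xs +ᴹ eval f ys
        eval-++ []       ys = ≈ᴹ-sym (+ᴹ-identityˡ _)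
        eval-++ (x ∷ xs) ys = ≈ᴹ-trans (+ᴹ-congˡ (eval-++ xs ys)) (≈ᴹ-sym (+ᴹ-assoc _ _ _))

        eval-scale : ∀ k xs → eval f (scale K k xs) ≈ᴹ k *ₗ eval f xs
        eval-scale k []       = ≈ᴹ-sym (*ₗ-zeroʳ k)
        eval-scale k (x ∷ xs) = ≈ᴹ-trans (+ᴹ-cong (*ₗ-assoc k _ _) (eval-scale k xs))
                                         (≈ᴹ-sym (*ₗ-distribˡ k _ _))

        eval-single : ∀ x → eval f (single K x) ≈ᴹ f x
        eval-single x = ≈ᴹ-trans (+ᴹ-identityʳ _) (*ₗ-identityˡ _)

        -- The universal property of Vect(X/R): one case per generating relation, with the
        -- hypothesis covering `lbasis`.
        eval-resp : {R : X → X → Set} → (∀ {x y} → R x y → f x ≈ᴹ f y) →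
                    ∀ {xs ys} → LinEq K R xs ys → eval f xs ≈ᴹ eval f ys
        eval-resp r lrefl             = ≈ᴹ-refl
        eval-resp r (lsym e)          = ≈ᴹ-sym (eval-resp r e)
        eval-resp r (ltrans e e′)     = ≈ᴹ-trans (eval-resp r e) (eval-resp r e′)
        eval-resp r (lapp {xs} {xs′} {ys} {ys′} e e′) =
          ≈ᴹ-trans (eval-++ xs ys)
          (≈ᴹ-trans (+ᴹ-cong (eval-resp r e) (eval-resp r e′)) (≈ᴹ-sym (eval-++ xs′ ys′)))
        eval-resp r (lswap {xs} {ys}) =
          ≈ᴹ-trans (eval-++ xs ys) (≈ᴹ-trans (+ᴹ-comm _ _) (≈ᴹ-sym (eval-++ ys xs)))
        eval-resp r lmerge            =
          ≈ᴹ-trans (≈ᴹ-sym (+ᴹ-assoc _ _ _)) (+ᴹ-congʳ (≈ᴹ-sym (*ₗ-distribʳ _ _ _)))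
        eval-resp r lzero             = ≈ᴹ-trans (+ᴹ-identityʳ _) (*ₗ-zeroˡ _)
        eval-resp r (lcoef e)         = +ᴹ-congʳ (*ₗ-congʳ e)
        eval-resp r (lbasis e)        = +ᴹ-congʳ (*ₗ-congˡ (r e))

        eval-linear : (R : X → X → Set) → (∀ {x y} → R x y → f x ≈ᴹ f y) → Linear (free R) M (eval f)
        eval-linear R r = record { cong = eval-resp r ; +-homo = eval-++ ; *-homo = eval-scale }

        eval-bind : {Y : Set} (h : Y → Lin K X) → ∀ ys →
                    eval f (bind K h ys) ≈ᴹ eval (λ y → eval f (h y)) ys
        eval-bind h []       = ≈ᴹ-refl
        eval-bind h (y ∷ ys) = ≈ᴹ-trans (eval-++ (scale K _ (h _)) _)
                                        (+ᴹ-cong (eval-scale _ (h _)) (eval-bind h ys))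

    eval-linMap : {X Y : Set} (f : X → Carrierᴹ) (h : Y → X) → ∀ ys →
                  eval f (linMap K h ys) ≈ᴹ eval (f ∘ h) ys
    eval-linMap f h ys = ≈ᴹ-trans (eval-bind f (λ y → single K (h y)) ys)
                                  (eval-cong (λ y → eval-single f (h y)) ys)

    -- Fubini for finite sums.
    eval-comm : {X Y : Set} (f : X → Y → Carrierᴹ) → ∀ xs ys →
                eval (λ x → eval (f x) ys) xs ≈ᴹ eval (λ y → eval (λ x → f x y) xs) ys
    eval-comm f []             ys = ≈ᴹ-sym (eval-0 ys)
    eval-comm f ((a , x) ∷ xs) ys =
      ≈ᴹ-trans (+ᴹ-cong (≈ᴹ-sym (eval-* a (f x) ys)) (eval-comm f xs ys))
               (≈ᴹ-sym (eval-+ _ _ ys))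

  module _ {m ℓm n ℓn : Level} (M : Mod m ℓm) (N : Mod n ℓn) where
    private
      module M = Module M
      module N = Module N

    linear-eval : ∀ {f} → Linear M N f → {X : Set} (g : X → M.Carrierᴹ) → ∀ xs →
                  f (eval M g xs) N.≈ᴹ eval N (f ∘ g) xs
    linear-eval lf g []       = Linear.0-homo lf
    linear-eval lf g (x ∷ xs) =
      N.≈ᴹ-trans (Linear.+-homo lf _ _)
                 (N.+ᴹ-cong (Linear.*-homo lf _ _) (linear-eval lf g xs))

    linear-ext : ∀ {f g} → (∀ x → f x N.≈ᴹ g x) → Linear M N g → Linear M N f
    linear-ext f≈g lg = record
      { cong   = λ x≈y → N.≈ᴹ-trans (f≈g _) (N.≈ᴹ-trans (G.cong x≈y) (N.≈ᴹ-sym (f≈g _)))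
      ; +-homo = λ x y → N.≈ᴹ-trans (f≈g _) (N.≈ᴹ-trans (G.+-homo x y)
                           (N.+ᴹ-cong (N.≈ᴹ-sym (f≈g _)) (N.≈ᴹ-sym (f≈g _))))
      ; *-homo = λ k x → N.≈ᴹ-trans (f≈g _) (N.≈ᴹ-trans (G.*-homo k x)
                           (N.*ₗ-congˡ (N.≈ᴹ-sym (f≈g _))))
      }
      where module G = Linear lg

    linear-0 : Linear M N (λ _ → N.0ᴹ)
    linear-0 = record
      { cong   = λ _ → N.≈ᴹ-refl
      ; +-homo = λ _ _ → N.≈ᴹ-sym (N.+ᴹ-identityˡ _)
      ; *-homo = λ _ _ → N.≈ᴹ-sym (N.*ₗ-zeroʳ _)
      }

    linear-+ : ∀ {f g} → Linear M N f → Linear M N g → Linear M N (λ x → f x N.+ᴹ g x)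
    linear-+ lf lg = record
      { cong   = λ e → N.+ᴹ-cong (F.cong e) (G.cong e)
      ; +-homo = λ x y → N.≈ᴹ-trans (N.+ᴹ-cong (F.+-homo x y) (G.+-homo x y))
                                    (+-interchange N _ _ _ _)
      ; *-homo = λ k x → N.≈ᴹ-trans (N.+ᴹ-cong (F.*-homo k x) (G.*-homo k x))
                                    (N.≈ᴹ-sym (N.*ₗ-distribˡ k _ _))
      }
      where
      module F = Linear lf
      module G = Linear lg

    linear-* : ∀ k {f} → Linear M N f → Linear M N (λ x → k N.*ₗ f x)
    linear-* k lf = record
      { cong   = λ e → N.*ₗ-congˡ (F.cong e)
      ; +-homo = λ x y → N.≈ᴹ-trans (N.*ₗ-congˡ (F.+-homo x y)) (N.*ₗ-distribˡ k _ _)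
      ; *-homo = λ k′ x → N.≈ᴹ-trans (N.*ₗ-congˡ (F.*-homo k′ x)) (N.*ₗ-comm k k′ _)
      }
      where module F = Linear lf

    eval-linearʳ : {X : Set} (f : X → M.Carrierᴹ → N.Carrierᴹ) → (∀ x → Linear M N (f x)) →
                   ∀ xs → Linear M N (λ y → eval N (λ x → f x y) xs)
    eval-linearʳ f lf []             = linear-0
    eval-linearʳ f lf ((k , x) ∷ xs) = linear-+ (linear-* k (lf x)) (eval-linearʳ f lf xs)

  module _ {m ℓm : Level} (M : Mod m ℓm) where
    open Module M

    linear-id : Linear M M id
    linear-id = record { cong = id ; +-homo = λ _ _ → ≈ᴹ-refl ; *-homo = λ _ _ → ≈ᴹ-refl }

    -- Negation is specified only by the group axioms; uniqueness of inverses identifies it with the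
    -- scalar -1.
    linear-neg : Linear M M -ᴹ_
    linear-neg = linear-ext M M neg≈ (linear-* M M (- 1#) linear-id)
      where
      open AbelianGroupProperties +ᴹ-abelianGroup using (inverseʳ-unique)
      neg≈ : ∀ x → -ᴹ x ≈ᴹ (- 1#) *ₗ x
      neg≈ x = ≈ᴹ-sym (inverseʳ-unique x _
        (≈ᴹ-trans (+ᴹ-congʳ (≈ᴹ-sym (*ₗ-identityˡ x)))
        (≈ᴹ-trans (≈ᴹ-sym (*ₗ-distribʳ x 1# (- 1#)))
        (≈ᴹ-trans (*ₗ-congʳ (-‿inverseʳ 1#)) (*ₗ-zeroˡ x)))))

    linear-∘ : ∀ {p ℓp n ℓn} (P : Mod p ℓp) (N : Mod n ℓn) {f g} →
               Linear M N f → Linear P M g → Linear P N (f ∘ g)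
    linear-∘ P N lf lg = record
      { cong   = λ e → F.cong (G.cong e)
      ; +-homo = λ x y → N.≈ᴹ-trans (F.cong (G.+-homo x y)) (F.+-homo _ _)
      ; *-homo = λ k x → N.≈ᴹ-trans (F.cong (G.*-homo k x)) (F.*-homo k _)
      }
      where
      module N = Module N
      module F = Linear lf
      module G = Linear lg

  single-expansion : {X : Set} (R : X → X → Set) (xs : Lin K X) → LinEq K R xs (bind K (single K) xs)
  single-expansion R []       = lrefl
  single-expansion R (x ∷ xs) = lapp (lcoef (sym (*-identityʳ _))) (single-expansion R xs)

  linear-free : ∀ {n ℓn} {X : Set} (R : X → X → Set) (N : Mod n ℓn) → ∀ {f} →
                Linear (free R) N f → ∀ xs → Module._≈ᴹ_ N (f xs) (eval N (f ∘ single K) xs)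
  linear-free R N lf xs =
    Module.≈ᴹ-trans N (Linear.cong lf (single-expansion R xs)) (linear-eval (free R) N lf (single K) xs)

-- Derivations of multilinear maps

module Derivations {c ℓ : Level} (K : Field c ℓ) (I : Set) where
  open LinearAlgebra K

  -- ∂ D k (y₁ … yₙ) = Σᵢ k (y₁ … D yᵢ … yₙ)
  module _ {n ℓn : Level} (N : Mod n ℓn) where
    open Module N

    ∂ : ∀ {y} {Y : Set y} → (Y → Y) → (List (I × Y) → Carrierᴹ) → List (I × Y) → Carrierᴹ
    ∂ D k []             = 0ᴹ
    ∂ D k ((e , y) ∷ ys) = k ((e , D y) ∷ ys) +ᴹ ∂ D (λ zs → k ((e , y) ∷ zs)) ys

    -- A derivation changes entries but not their number. Knowing the length is what lets the bound
    -- of `brace` be adjusted under `∂` in `braces-∷`; for `∂ᵇ-cong` it is what the induction on the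
    -- number of root branches in `G-node` needs.
    ∂-cong : ∀ {y} {Y : Set y} (D : Y → Y) {k k′ : List (I × Y) → Carrierᴹ} ys →
             (∀ zs → length zs ≡ length ys → k zs ≈ᴹ k′ zs) → ∂ D k ys ≈ᴹ ∂ D k′ ys
    ∂-cong D []             k≈ = ≈ᴹ-refl
    ∂-cong D ((e , y) ∷ ys) k≈ =
      +ᴹ-cong (k≈ _ ≡.refl) (∂-cong D ys (λ zs eq → k≈ _ (≡.cong suc eq)))

    ∂-+ : ∀ {y} {Y : Set y} (D : Y → Y) (k k′ : List (I × Y) → Carrierᴹ) ys →
          ∂ D (λ zs → k zs +ᴹ k′ zs) ys ≈ᴹ ∂ D k ys +ᴹ ∂ D k′ ys
    ∂-+ D k k′ []       = ≈ᴹ-sym (+ᴹ-identityˡ _)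
    ∂-+ D k k′ (y ∷ ys) = ≈ᴹ-trans (+ᴹ-congˡ (∂-+ D _ _ ys)) (+-interchange N _ _ _ _)

    ∂-0 : ∀ {y} {Y : Set y} (D : Y → Y) ys → ∂ D (λ _ → 0ᴹ) ys ≈ᴹ 0ᴹ
    ∂-0 D []       = ≈ᴹ-refl
    ∂-0 D (y ∷ ys) = ≈ᴹ-trans (+ᴹ-identityˡ _) (∂-0 D ys)

    ∂-linear-k : ∀ {p ℓp} (P : Mod p ℓp) {y} {Y : Set y} (D : Y → Y)
                 (k : Module.Carrierᴹ P → List (I × Y) → Carrierᴹ) →
                 (∀ zs → Linear P N (λ z → k z zs)) → ∀ ys → Linear P N (λ z → ∂ D (k z) ys)
    ∂-linear-k P D k lk []       = linear-0 P N
    ∂-linear-k P D k lk (y ∷ ys) =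
      linear-+ P N (lk _) (∂-linear-k P D (λ z zs → k z (y ∷ zs)) (λ zs → lk (y ∷ zs)) ys)

    ∂-eval : ∀ {y} {Y : Set y} {X : Set} (D : Y → Y) (k : X → List (I × Y) → Carrierᴹ) xs ys →
             eval N (λ x → ∂ D (k x) ys) xs ≈ᴹ ∂ D (λ zs → eval N (λ x → k x zs) xs) ys
    ∂-eval D k xs []       = eval-0 N xs
    ∂-eval D k xs (y ∷ ys) =
      ≈ᴹ-trans (eval-+ N _ _ xs) (+ᴹ-congˡ (∂-eval D (λ x zs → k x (y ∷ zs)) xs ys))

    -- ∂ on lists of basis elements; `graftCh` has this shape.
    ∂ᵇ : {X : Set} → (X → Lin K X) → (List (I × X) → Carrierᴹ) → List (I × X) → Carrierᴹ
    ∂ᵇ D k []             = 0ᴹ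
    ∂ᵇ D k ((e , x) ∷ xs) =
      eval N (λ z → k ((e , z) ∷ xs)) (D x) +ᴹ ∂ᵇ D (λ zs → k ((e , x) ∷ zs)) xs

    module _ {X : Set} where

      ∂ᵇ-cong : (D : X → Lin K X) {k k′ : List (I × X) → Carrierᴹ} → ∀ xs →
                (∀ zs → length zs ≡ length xs → k zs ≈ᴹ k′ zs) → ∂ᵇ D k xs ≈ᴹ ∂ᵇ D k′ xs
      ∂ᵇ-cong D []             k≈ = ≈ᴹ-refl
      ∂ᵇ-cong D ((e , x) ∷ xs) k≈ =
        +ᴹ-cong (eval-cong N (λ z → k≈ _ ≡.refl) (D x))
                (∂ᵇ-cong D xs (λ zs eq → k≈ _ (≡.cong suc eq)))

      -- Passes from grafting single trees to grafting a combination of them: the sum over grafted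
      -- trees can be carried out inside each branch.
      ∂ᵇ-bind : {Z : Set} (D : Z → X → Lin K X) (k : List (I × X) → Carrierᴹ) → ∀ zs xs →
                eval N (λ z → ∂ᵇ (D z) k xs) zs ≈ᴹ ∂ᵇ (λ x → bind K (λ z → D z x) zs) k xs
      ∂ᵇ-bind D k zs []             = eval-0 N zs
      ∂ᵇ-bind D k zs ((e , x) ∷ xs) =
        ≈ᴹ-trans (eval-+ N _ _ zs)
          (+ᴹ-cong (≈ᴹ-sym (eval-bind N _ (λ z → D z x) zs))
                   (∂ᵇ-bind D (λ ws → k ((e , x) ∷ ws)) zs xs))

  module _ {n ℓn p ℓp : Level} (N : Mod n ℓn) (P : Mod p ℓp) where
    open Module P

    ∂-apply : ∀ {f} → Linear N P f → ∀ {y} {Y : Set y} (D : Y → Y) k ys →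
              f (∂ N D k ys) ≈ᴹ ∂ P D (f ∘ k) ys
    ∂-apply lf D k []       = Linear.0-homo lf
    ∂-apply lf D k (y ∷ ys) =
      ≈ᴹ-trans (Linear.+-homo lf _ _) (+ᴹ-congˡ (∂-apply lf D (λ zs → k (y ∷ zs)) ys))

    ∂ᵇ-apply : ∀ {f} → Linear N P f → {X : Set} (D : X → Lin K X) → ∀ k xs →
               f (∂ᵇ N D k xs) ≈ᴹ ∂ᵇ P D (f ∘ k) xs
    ∂ᵇ-apply lf D k []             = Linear.0-homo lf
    ∂ᵇ-apply lf D k ((e , x) ∷ xs) =
      ≈ᴹ-trans (Linear.+-homo lf _ _)
        (+ᴹ-cong (linear-eval N P lf (λ z → k ((e , z) ∷ xs)) (D x))
                 (∂ᵇ-apply lf D (λ zs → k ((e , x) ∷ zs)) xs))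

  module _ {m ℓm : Level} (M : Mod m ℓm) where
    open Module M

    infix 4 _∼_

    -- Permutation generated by adjacent transpositions, together with equality of entries, so that
    -- symmetry of a function has only one essential case, `swap`.
    data _∼_ : List (I × Carrierᴹ) → List (I × Carrierᴹ) → Set (m ⊔ ℓm) where
      nil  : [] ∼ []
      skip : ∀ {a y y′ ys ys′} → y ≈ᴹ y′ → ys ∼ ys′ → ((a , y) ∷ ys) ∼ ((a , y′) ∷ ys′)
      swap : ∀ p q ys → (p ∷ q ∷ ys) ∼ (q ∷ p ∷ ys)
      comp : ∀ {xs ys zs} → xs ∼ ys → ys ∼ zs → xs ∼ zs

    ∼-refl : ∀ ys → ys ∼ ys
    ∼-refl []       = nil
    ∼-refl (y ∷ ys) = skip ≈ᴹ-refl (∼-refl ys)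

    ∼-length : ∀ {xs ys} → xs ∼ ys → length xs ≡ length ys
    ∼-length nil           = ≡.refl
    ∼-length (skip _ e)    = ≡.cong suc (∼-length e)
    ∼-length (swap p q ys) = ≡.refl
    ∼-length (comp e e′)   = ≡.trans (∼-length e) (∼-length e′)

    ∼-pointwise : {X : Set} (f g : X → Carrierᴹ) (xs : List (I × X)) →
                  All (λ p → f (proj₂ p) ≈ᴹ g (proj₂ p)) xs →
                  List.map (map₂ f) xs ∼ List.map (map₂ g) xs
    ∼-pointwise f g []       []         = nil
    ∼-pointwise f g (x ∷ xs) (e ∷ es) = skip e (∼-pointwise f g xs es)

    ∼-move : ∀ p ys zs → (p ∷ ys ++ zs) ∼ (ys ++ p ∷ zs)
    ∼-move p []       zs = ∼-refl _
    ∼-move p (q ∷ ys) zs = comp (swap p q (ys ++ zs)) (skip ≈ᴹ-refl (∼-move p ys zs))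

  module _ {m ℓm n ℓn : Level} (M : Mod m ℓm) (N : Mod n ℓn) where
    private
      module M = Module M
      open Module N
      Y = M.Carrierᴹ

    Symmetric : (List (I × Y) → Carrierᴹ) → Set _
    Symmetric k = ∀ {ys zs} → _∼_ M ys zs → k ys ≈ᴹ k zs

    Multilinear : (List (I × Y) → Carrierᴹ) → Set _
    Multilinear k = ∀ xs e ys → Linear M N (λ y → k (xs ++ (e , y) ∷ ys))

    ∂-multilinear : ∀ {D} → Linear M M D → ∀ k → Multilinear k → Multilinear (∂ N D k)
    ∂-multilinear {D} lD k mk [] e ys =
      linear-+ M N (linear-∘ M M N (mk [] e ys) lD)
        (∂-linear-k N M D (λ y zs → k ((e , y) ∷ zs)) (mk [] e) ys)
    ∂-multilinear {D} lD k mk ((e′ , x) ∷ xs) e ys =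
      linear-+ M N (mk ((e′ , D x) ∷ xs) e ys)
        (∂-multilinear lD (λ zs → k ((e′ , x) ∷ zs)) (λ xs → mk ((e′ , x) ∷ xs)) xs e ys)

    ∂-linear-D : ∀ {p ℓp} (P : Mod p ℓp) (D : Module.Carrierᴹ P → Y → Y) →
                 (∀ z → Linear P M (λ w → D w z)) →
                 ∀ k → Multilinear k → ∀ ys → Linear P N (λ w → ∂ N (D w) k ys)
    ∂-linear-D P D lD k mk []             = linear-0 P N
    ∂-linear-D P D lD k mk ((e , y) ∷ ys) =
      linear-+ P N (linear-∘ M P N (mk [] e ys) (lD y))
        (∂-linear-D P D lD (λ zs → k ((e , y) ∷ zs)) (λ xs → mk ((e , y) ∷ xs)) ys)

    ∂-cong₂ : {D D′ : Y → Y} → (∀ z → D z M.≈ᴹ D′ z) →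
              ∀ {k k′} → (∀ {ys zs} → _∼_ M ys zs → k ys ≈ᴹ k′ zs) →
              ∀ ys → ∂ N D k ys ≈ᴹ ∂ N D′ k′ ys
    ∂-cong₂ D≈ k≈ []             = ≈ᴹ-refl
    ∂-cong₂ D≈ k≈ ((e , y) ∷ ys) =
      +ᴹ-cong (k≈ (skip (D≈ y) (∼-refl M ys))) (∂-cong₂ D≈ (λ e → k≈ (skip M.≈ᴹ-refl e)) ys)

    -- Two operators and two functions are needed because under `skip` the two sides fix different,
    -- merely equal, heads; in `brace-symmetric` the operators differ for the same reason.
    ∂-symmetric : {D D′ : Y → Y} → (∀ {z z′} → z M.≈ᴹ z′ → D z M.≈ᴹ D′ z′) →
                  ∀ {k k′} → (∀ {ys zs} → _∼_ M ys zs → k ys ≈ᴹ k′ zs) →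
                  ∀ {ys zs} → _∼_ M ys zs → ∂ N D k ys ≈ᴹ ∂ N D′ k′ zs
    ∂-symmetric D≈ k≈ nil = ≈ᴹ-refl
    ∂-symmetric D≈ k≈ (skip y≈ e) =
      +ᴹ-cong (k≈ (skip (D≈ y≈) e)) (∂-symmetric D≈ (λ e′ → k≈ (skip y≈ e′)) e)
    ∂-symmetric {D} {D′} D≈ {k} {k′} k≈ (swap (a , y) (b , z) ys) = begin
      k ((a , D y) ∷ (b , z) ∷ ys) +ᴹ (k ((a , y) ∷ (b , D z) ∷ ys) +ᴹ ∂ N D _ ys)
        ≈⟨ +ᴹ-assoc _ _ _ ⟨
      (k ((a , D y) ∷ (b , z) ∷ ys) +ᴹ k ((a , y) ∷ (b , D z) ∷ ys)) +ᴹ ∂ N D _ ys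
        ≈⟨ +ᴹ-cong (+ᴹ-comm _ _) (∂-cong₂ (λ _ → D≈ M.≈ᴹ-refl)
             (λ e → k≈ (comp (skip M.≈ᴹ-refl (skip M.≈ᴹ-refl e)) (swap _ _ _))) ys) ⟩
      (k ((a , y) ∷ (b , D z) ∷ ys) +ᴹ k ((a , D y) ∷ (b , z) ∷ ys)) +ᴹ ∂ N D′ _ ys
        ≈⟨ +ᴹ-congʳ (+ᴹ-cong
             (k≈ (comp (skip M.≈ᴹ-refl (skip (D≈ M.≈ᴹ-refl) (∼-refl M ys))) (swap _ _ _)))
             (k≈ (comp (skip (D≈ M.≈ᴹ-refl) (∼-refl M _)) (swap _ _ _)))) ⟩
      (k′ ((b , D′ z) ∷ (a , y) ∷ ys) +ᴹ k′ ((b , z) ∷ (a , D′ y) ∷ ys)) +ᴹ ∂ N D′ _ ys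
        ≈⟨ +ᴹ-assoc _ _ _ ⟩
      k′ ((b , D′ z) ∷ (a , y) ∷ ys) +ᴹ (k′ ((b , z) ∷ (a , D′ y) ∷ ys) +ᴹ ∂ N D′ _ ys) ∎
      where open SetoidReasoning ≈ᴹ-setoid
    -- The first half already passes to `D′` and `k′`; that these respect equality by themselves is
    -- recovered by a detour through `D` and `k`.
    ∂-symmetric {D} {D′} D≈ {k} {k′} k≈ (comp e e′) =
      ≈ᴹ-trans (∂-symmetric {D} {D′} D≈ {k} {k′} k≈ e) (∂-symmetric {D′} {D′}
        (λ z≈ → M.≈ᴹ-trans (M.≈ᴹ-sym (D≈ M.≈ᴹ-refl)) (D≈ z≈)) {k′} {k′}
        (λ e″ → ≈ᴹ-trans (≈ᴹ-sym (k≈ (∼-refl M _))) (k≈ e″)) e′)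

    -- The terms of ∂ Q (∂ P k) hitting two different entries are symmetric in P and Q.
    ∂-commutator : (P Q S S′ : Y → Y) → ∀ k → Multilinear k → ∀ ys →
                   All (λ y → (P (Q (proj₂ y)) M.+ᴹ S′ (proj₂ y)) M.≈ᴹ
                              (Q (P (proj₂ y)) M.+ᴹ S (proj₂ y))) ys →
                   ∂ N Q (∂ N P k) ys +ᴹ ∂ N S′ k ys ≈ᴹ ∂ N P (∂ N Q k) ys +ᴹ ∂ N S k ys
    ∂-commutator P Q S S′ k mk [] [] = ≈ᴹ-refl
    ∂-commutator P Q S S′ k mk ((e , y) ∷ ys) (h ∷ hs) = begin
      ((k (at (P (Q y))) +ᴹ X) +ᴹ ∂ N Q (λ zs → k ((e , P y) ∷ zs) +ᴹ ∂ N P k′ zs) ys)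
        +ᴹ (k (at (S′ y)) +ᴹ ∂ N S′ k′ ys)
        ≈⟨ +ᴹ-congʳ (+ᴹ-congˡ (∂-+ N Q _ _ ys)) ⟩
      ((k (at (P (Q y))) +ᴹ X) +ᴹ (X′ +ᴹ ∂ N Q (∂ N P k′) ys)) +ᴹ (k (at (S′ y)) +ᴹ ∂ N S′ k′ ys)
        ≈⟨ rearrange _ _ _ _ _ _ ⟩
      (k (at (P (Q y))) +ᴹ k (at (S′ y))) +ᴹ ((X +ᴹ X′) +ᴹ (∂ N Q (∂ N P k′) ys +ᴹ ∂ N S′ k′ ys))
        -- `∂ N Q (∂ N P k)` applies `Q` first, so a doubly hit head is `P (Q y)`. There `h` is
        -- used, in both applications a pre-Lie identity for the branch `y`, with `S` and `S′` the
        -- actions of the products of the two grafted elements.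
        ≈⟨ +ᴹ-cong (slot h) (+ᴹ-cong (+ᴹ-comm X X′)
             (∂-commutator P Q S S′ k′ (λ xs → mk ((e , y) ∷ xs)) ys hs)) ⟩
      (k (at (Q (P y))) +ᴹ k (at (S y))) +ᴹ ((X′ +ᴹ X) +ᴹ (∂ N P (∂ N Q k′) ys +ᴹ ∂ N S k′ ys))
        ≈⟨ rearrange _ _ _ _ _ _ ⟨
      ((k (at (Q (P y))) +ᴹ X′) +ᴹ (X +ᴹ ∂ N P (∂ N Q k′) ys)) +ᴹ (k (at (S y)) +ᴹ ∂ N S k′ ys)
        ≈⟨ +ᴹ-congʳ (+ᴹ-congˡ (∂-+ N P _ _ ys)) ⟨
      ((k (at (Q (P y))) +ᴹ X′) +ᴹ ∂ N P (λ zs → k ((e , Q y) ∷ zs) +ᴹ ∂ N Q k′ zs) ys)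
        +ᴹ (k (at (S y)) +ᴹ ∂ N S k′ ys) ∎
      where
      open SetoidReasoning ≈ᴹ-setoid
      at : Y → List (I × Y)
      at z = (e , z) ∷ ys
      k′ : List (I × Y) → Carrierᴹ
      k′ zs = k ((e , y) ∷ zs)
      X X′ : Carrierᴹ
      X  = ∂ N P (λ zs → k ((e , Q y) ∷ zs)) ys
      X′ = ∂ N Q (λ zs → k ((e , P y) ∷ zs)) ys
      slot : ∀ {u u′ v v′} → (u M.+ᴹ u′) M.≈ᴹ (v M.+ᴹ v′) →
             k (at u) +ᴹ k (at u′) ≈ᴹ k (at v) +ᴹ k (at v′)
      slot h = ≈ᴹ-trans (≈ᴹ-sym (Linear.+-homo (mk [] e ys) _ _))
                 (≈ᴹ-trans (Linear.cong (mk [] e ys) h) (Linear.+-homo (mk [] e ys) _ _))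
      open CommutativeMonoidSolver +ᴹ-commutativeMonoid
      rearrange : ∀ a x x′ b s t → ((a +ᴹ x) +ᴹ (x′ +ᴹ b)) +ᴹ (s +ᴹ t) ≈ᴹ
                                   (a +ᴹ s) +ᴹ ((x +ᴹ x′) +ᴹ (b +ᴹ t))
      rearrange = solve 6 (λ a x x′ b s t → (((a ⊕ x) ⊕ (x′ ⊕ b)) ⊕ (s ⊕ t)) ⊜
                                            ((a ⊕ s) ⊕ ((x ⊕ x′) ⊕ (b ⊕ t)))) ≈ᴹ-refl

    -- Lifts "g intertwines D with E" from branches to the whole list. It is asked only for the
    -- entries of `xs`, so that an induction hypothesis on the children of a node can be supplied.
    ∂ᵇ-natural : {X : Set} (g : X → Y) (D : X → Lin K X) (E : Y → Y) →
                 ∀ k → Multilinear k → ∀ xs →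
                 All (λ p → eval M g (D (proj₂ p)) M.≈ᴹ E (g (proj₂ p))) xs →
                 ∂ᵇ N D (k ∘ List.map (map₂ g)) xs ≈ᴹ ∂ N E k (List.map (map₂ g) xs)
    ∂ᵇ-natural g D E k mk [] [] = ≈ᴹ-refl
    ∂ᵇ-natural g D E k mk ((e , x) ∷ xs) (h ∷ hs) = +ᴹ-cong
      (≈ᴹ-trans (≈ᴹ-sym (linear-eval M N (mk [] e _) g (D x))) (Linear.cong (mk [] e _) h))
      (∂ᵇ-natural g D E (λ zs → k ((e , g x) ∷ zs)) (λ ys → mk ((e , g x) ∷ ys)) xs hs)

-- The endomorphism φ^λ

module Shifts {c ℓ : Level} (K : Field c ℓ) where
  open Field K
  open LinearAlgebra K

  natK-+ : ∀ i j → natK K (i ℕ.+ j) ≈ natK K i + natK K j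
  natK-+ zero    j = sym (+-identityˡ _)
  natK-+ (suc i) j = trans (+-congˡ (natK-+ i j)) (sym (+-assoc _ _ _))

  natK-* : ∀ i j → natK K (i ℕ.* j) ≈ natK K i * natK K j
  natK-* zero    j = sym (zeroˡ _)
  natK-* (suc i) j = trans (natK-+ j (i ℕ.* j))
    (trans (+-cong (sym (*-identityˡ _)) (natK-* i j)) (sym (distribʳ _ _ _)))

  φ₁ : Carrier → ℕ × ℕ → Lin K (ℕ × ℕ)
  φ₁ x (a , b) = List.map (λ l → (powK K x l * natK K (b C l) , (a ∸ l , b ∸ l))) (upTo (suc (a ⊓ b)))

  module _ {m ℓm : Level} (M : Mod m ℓm) where
    open Module M
    open SetoidReasoning ≈ᴹ-setoid

    opaque
      -- Opaque, so that the one-coordinate inductions below see only the two boundary values, the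
      -- shift rule and linearity in `k`.
      eval₁ : Carrier → ℕ → ℕ → (ℕ → ℕ → Carrierᴹ) → Carrierᴹ
      eval₁ x a b k = eval M (λ p → k (proj₁ p) (proj₂ p)) (φ₁ x (a , b))

    -- Σ_{l ≤ min a b} w l · k (a − l) (b − l), recursively.
    descend : (ℕ → Carrier) → ℕ → ℕ → (ℕ → ℕ → Carrierᴹ) → Carrierᴹ
    descend w zero    b       k = w 0 *ₗ k 0 b
    descend w (suc a) zero    k = w 0 *ₗ k (suc a) 0
    descend w (suc a) (suc b) k = w 0 *ₗ k (suc a) (suc b) +ᴹ descend (w ∘ suc) a b k

    -- The weights are arbitrary because splitting off the term l = 0 shifts them.
    eval-descend : ∀ w a b k →
      eval M (λ p → k (proj₁ p) (proj₂ p)) (List.map (λ l → (w l , (a ∸ l , b ∸ l))) (upTo (suc (a ⊓ b))))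
        ≈ᴹ descend w a b k
    eval-descend w a b k =
      ≈ᴹ-trans (≈ᴹ-reflexive (≡.cong (eval M _) (List.map-upTo _ (suc (a ⊓ b))))) (go w a b)
      where
      go : ∀ w a b → eval M (λ p → k (proj₁ p) (proj₂ p))
                       (applyUpTo (λ l → (w l , (a ∸ l , b ∸ l))) (suc (a ⊓ b))) ≈ᴹ descend w a b k
      go w zero    b       = +ᴹ-identityʳ _
      go w (suc a) zero    = +ᴹ-identityʳ _
      go w (suc a) (suc b) = +ᴹ-congˡ (go (w ∘ suc) a b)

    descend-cong : ∀ {w w′} → (∀ l → w l ≈ w′ l) → ∀ a b k → descend w a b k ≈ᴹ descend w′ a b k
    descend-cong w≈ zero    b       k = *ₗ-congʳ (w≈ 0)
    descend-cong w≈ (suc a) zero    k = *ₗ-congʳ (w≈ 0)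
    descend-cong w≈ (suc a) (suc b) k = +ᴹ-cong (*ₗ-congʳ (w≈ 0)) (descend-cong (w≈ ∘ suc) a b k)

    descend-+ : ∀ w w′ a b k →
                descend (λ l → w l + w′ l) a b k ≈ᴹ descend w a b k +ᴹ descend w′ a b k
    descend-+ w w′ zero    b       k = *ₗ-distribʳ _ _ _
    descend-+ w w′ (suc a) zero    k = *ₗ-distribʳ _ _ _
    descend-+ w w′ (suc a) (suc b) k =
      ≈ᴹ-trans (+ᴹ-cong (*ₗ-distribʳ _ _ _) (descend-+ _ _ a b k)) (+-interchange M _ _ _ _)

    descend-* : ∀ x w a b k → descend (λ l → x * w l) a b k ≈ᴹ x *ₗ descend w a b k
    descend-* x w zero    b       k = *ₗ-assoc _ _ _
    descend-* x w (suc a) zero    k = *ₗ-assoc _ _ _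
    descend-* x w (suc a) (suc b) k =
      ≈ᴹ-trans (+ᴹ-cong (*ₗ-assoc _ _ _) (descend-* x _ a b k)) (≈ᴹ-sym (*ₗ-distribˡ _ _ _))

    descend-0 : ∀ {w} → w 0 ≈ 0# → ∀ a k → descend w a 0 k ≈ᴹ 0ᴹ
    descend-0 w0 zero    k = ≈ᴹ-trans (*ₗ-congʳ w0) (*ₗ-zeroˡ _)
    descend-0 w0 (suc a) k = ≈ᴹ-trans (*ₗ-congʳ w0) (*ₗ-zeroˡ _)

    -- Raising b by one admits at most the further term l = b + 1, whose weight vanishes; for
    -- binomial weights this is C(b, b + 1) = 0.
    descend-suc : ∀ w a b k → (∀ l → b < l → w l ≈ 0#) →
                  descend w a b (λ a′ b′ → k a′ (suc b′)) ≈ᴹ descend w a (suc b) k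
    descend-suc w zero    b       k w0 = ≈ᴹ-refl
    descend-suc w (suc a) zero    k w0 =
      ≈ᴹ-sym (≈ᴹ-trans (+ᴹ-congˡ (descend-0 (w0 1 (s≤s z≤n)) a k)) (+ᴹ-identityʳ _))
    descend-suc w (suc a) (suc b) k w0 = +ᴹ-congˡ (descend-suc (w ∘ suc) a b k (λ l b<l → w0 (suc l) (s≤s b<l)))

    private
      weight : Carrier → ℕ → ℕ → Carrier
      weight x b l = powK K x l * natK K (b C l)

      weight-0 : ∀ x b → weight x b 0 ≈ 1#
      weight-0 x b = trans (*-identityˡ _) (+-identityʳ 1#)

      weight-suc : ∀ x b l → weight x (suc b) (suc l) ≈ x * weight x b l + weight x b (suc l)
      weight-suc x b l rewrite ≡.sym (nCk+nC[k+1]≡[n+1]C[k+1] b l) =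
        trans (*-congˡ (natK-+ (b C l) _)) (trans (distribˡ _ _ _) (+-congʳ (*-assoc _ _ _)))

      weight-> : ∀ x b l → b < l → weight x b l ≈ 0#
      weight-> x b l b<l rewrite k>n⇒nCk≡0 b<l = zeroʳ _

    opaque
      unfolding eval₁
      eval₁-zeroˡ : ∀ x b k → eval₁ x 0 b k ≈ᴹ k 0 b
      eval₁-zeroˡ x b k = ≈ᴹ-trans (+ᴹ-identityʳ _) (≈ᴹ-trans (*ₗ-congʳ (weight-0 x b)) (*ₗ-identityˡ _))

      eval₁-zeroʳ : ∀ x a k → eval₁ x a 0 k ≈ᴹ k a 0
      eval₁-zeroʳ x zero    k = eval₁-zeroˡ x 0 k
      eval₁-zeroʳ x (suc a) k =
        ≈ᴹ-trans (+ᴹ-identityʳ _) (≈ᴹ-trans (*ₗ-congʳ (weight-0 x 0)) (*ₗ-identityˡ _))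

      -- φ S = (S + x P) φ
      eval₁-suc : ∀ x a b k → eval₁ x (suc a) (suc b) k ≈ᴹ
                  eval₁ x (suc a) b (λ a′ b′ → k a′ (suc b′)) +ᴹ x *ₗ eval₁ x a b k
      eval₁-suc x a b k = begin
        eval₁ x (suc a) (suc b) k
          ≈⟨ eval-descend (weight x (suc b)) (suc a) (suc b) k ⟩
        weight x (suc b) 0 *ₗ k (suc a) (suc b) +ᴹ descend (weight x (suc b) ∘ suc) a b k
          ≈⟨ +ᴹ-cong (*ₗ-congʳ (trans (weight-0 x (suc b)) (sym (weight-0 x b))))
               (descend-cong (weight-suc x b) a b k) ⟩
        weight x b 0 *ₗ k (suc a) (suc b) +ᴹ descend (λ l → x * weight x b l + weight x b (suc l)) a b k
          ≈⟨ +ᴹ-congˡ (≈ᴹ-trans (descend-+ _ _ a b k) (+ᴹ-congʳ (descend-* x _ a b k))) ⟩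
        weight x b 0 *ₗ k (suc a) (suc b) +ᴹ (x *ₗ descend (weight x b) a b k +ᴹ descend (weight x b ∘ suc) a b k)
          ≈⟨ +ᴹ-congˡ (+ᴹ-comm _ _) ⟩
        weight x b 0 *ₗ k (suc a) (suc b) +ᴹ (descend (weight x b ∘ suc) a b k +ᴹ x *ₗ descend (weight x b) a b k)
          ≈⟨ +ᴹ-assoc _ _ _ ⟨
        descend (weight x b) (suc a) (suc b) k +ᴹ x *ₗ descend (weight x b) a b k
          ≈⟨ +ᴹ-congʳ (descend-suc (weight x b) (suc a) b k (weight-> x b)) ⟨
        descend (weight x b) (suc a) b (λ a′ b′ → k a′ (suc b′)) +ᴹ x *ₗ descend (weight x b) a b k
          ≈⟨ +ᴹ-cong (eval-descend (weight x b) (suc a) b _) (*ₗ-congˡ (eval-descend (weight x b) a b k)) ⟨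
        eval₁ x (suc a) b (λ a′ b′ → k a′ (suc b′)) +ᴹ x *ₗ eval₁ x a b k ∎

      eval₁-cong : ∀ x a b {k k′} → (∀ a b → k a b ≈ᴹ k′ a b) → eval₁ x a b k ≈ᴹ eval₁ x a b k′
      eval₁-cong x a b k≈ = eval-cong M (λ _ → k≈ _ _) (φ₁ x (a , b))

      eval₁-+ : ∀ x a b k k′ → eval₁ x a b (λ a b → k a b +ᴹ k′ a b) ≈ᴹ eval₁ x a b k +ᴹ eval₁ x a b k′
      eval₁-+ x a b k k′ = eval-+ M _ _ (φ₁ x (a , b))

      eval₁-* : ∀ x a b y k → eval₁ x a b (λ a b → y *ₗ k a b) ≈ᴹ y *ₗ eval₁ x a b k
      eval₁-* x a b y k = eval-* M y _ (φ₁ x (a , b))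

    -- Induction on b. Applying the shift rule on both edges shows that the composite of the two
    -- actions intertwines S with S + x P + y P′, where P and P′ lower a and c; this is symmetric in
    -- the two edges. When a decoration is 0, the corresponding action is the identity.
    eval₁-compatible : ∀ x y a c b (k : ℕ → ℕ → ℕ → Carrierᴹ) →
      eval₁ x a b (λ a′ b₁ → eval₁ y c b₁ (λ c′ b₂ → k a′ c′ b₂)) ≈ᴹ
      eval₁ y c b (λ c′ b₁ → eval₁ x a b₁ (λ a′ b₂ → k a′ c′ b₂))
    eval₁-compatible x y a c zero k = begin
      eval₁ x a 0 (λ a′ b₁ → eval₁ y c b₁ (k a′)) ≈⟨ eval₁-zeroʳ x a _ ⟩
      eval₁ y c 0 (k a)                           ≈⟨ eval₁-zeroʳ y c _ ⟩
      k a c 0                                     ≈⟨ eval₁-zeroʳ x a _ ⟨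
      eval₁ x a 0 (λ a′ → k a′ c)                 ≈⟨ eval₁-zeroʳ y c _ ⟨
      eval₁ y c 0 (λ c′ b₁ → eval₁ x a b₁ (λ a′ → k a′ c′)) ∎
    eval₁-compatible x y zero c (suc b) k = begin
      eval₁ x 0 (suc b) (λ a′ b₁ → eval₁ y c b₁ (k a′)) ≈⟨ eval₁-zeroˡ x (suc b) _ ⟩
      eval₁ y c (suc b) (k 0)                           ≈⟨ eval₁-cong y c (suc b) (λ c′ b₁ → eval₁-zeroˡ x b₁ _) ⟨
      eval₁ y c (suc b) (λ c′ b₁ → eval₁ x 0 b₁ (λ a′ → k a′ c′)) ∎
    eval₁-compatible x y (suc a) zero (suc b) k = begin
      eval₁ x (suc a) (suc b) (λ a′ b₁ → eval₁ y 0 b₁ (k a′))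
        ≈⟨ eval₁-cong x (suc a) (suc b) (λ a′ b₁ → eval₁-zeroˡ y b₁ _) ⟩
      eval₁ x (suc a) (suc b) (λ a′ → k a′ 0) ≈⟨ eval₁-zeroˡ y (suc b) _ ⟨
      eval₁ y 0 (suc b) (λ c′ b₁ → eval₁ x (suc a) b₁ (λ a′ → k a′ c′)) ∎
    eval₁-compatible x y (suc a) (suc c) (suc b) k = begin
      eval₁ x (suc a) (suc b) (λ a′ b₁ → eval₁ y (suc c) b₁ (k a′))
        ≈⟨ expand x y a c k ⟩
      (both (suc a) (suc c) kS +ᴹ y *ₗ both (suc a) c k) +ᴹ x *ₗ both a (suc c) k
        ≈⟨ +ᴹ-cong (+ᴹ-cong (eval₁-compatible x y (suc a) (suc c) b kS)
                            (*ₗ-congˡ (eval₁-compatible x y (suc a) c b k)))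
                   (*ₗ-congˡ (eval₁-compatible x y a (suc c) b k)) ⟩
      (both′ (suc a) (suc c) kS +ᴹ y *ₗ both′ (suc a) c k) +ᴹ x *ₗ both′ a (suc c) k
        ≈⟨ ≈ᴹ-trans (+ᴹ-assoc _ _ _) (≈ᴹ-trans (+ᴹ-congˡ (+ᴹ-comm _ _)) (≈ᴹ-sym (+ᴹ-assoc _ _ _))) ⟩
      (both′ (suc a) (suc c) kS +ᴹ x *ₗ both′ a (suc c) k) +ᴹ y *ₗ both′ (suc a) c k
        ≈⟨ expand y x c a (λ c′ a′ → k a′ c′) ⟨
      eval₁ y (suc c) (suc b) (λ c′ b₁ → eval₁ x (suc a) b₁ (λ a′ → k a′ c′)) ∎
      where
      kS : ℕ → ℕ → ℕ → Carrierᴹ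
      kS a′ c′ b′ = k a′ c′ (suc b′)
      both both′ : ℕ → ℕ → (ℕ → ℕ → ℕ → Carrierᴹ) → Carrierᴹ
      both  a c k = eval₁ x a b (λ a′ b₁ → eval₁ y c b₁ (k a′))
      both′ a c k = eval₁ y c b (λ c′ b₁ → eval₁ x a b₁ (λ a′ → k a′ c′))
      expand : ∀ x y a c (k : ℕ → ℕ → ℕ → Carrierᴹ) →
        eval₁ x (suc a) (suc b) (λ a′ b₁ → eval₁ y (suc c) b₁ (k a′)) ≈ᴹ
        (eval₁ x (suc a) b (λ a′ b₁ → eval₁ y (suc c) b₁ (λ c′ b₂ → k a′ c′ (suc b₂)))
         +ᴹ y *ₗ eval₁ x (suc a) b (λ a′ b₁ → eval₁ y c b₁ (k a′)))
         +ᴹ x *ₗ eval₁ x a b (λ a′ b₁ → eval₁ y (suc c) b₁ (k a′))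
      expand x y a c k = ≈ᴹ-trans (eval₁-suc x a b _) (+ᴹ-congʳ
        (≈ᴹ-trans (eval₁-cong x (suc a) b (λ a′ b₁ → eval₁-suc y c b₁ (k a′)))
        (≈ᴹ-trans (eval₁-+ x (suc a) b _ _) (+ᴹ-congˡ (eval₁-* x (suc a) b y _)))))

    private
      lower : (ℕ → Carrierᴹ) → ℕ → Carrierᴹ
      lower h zero    = 0ᴹ
      lower h (suc a) = h a

    -- φ commutes with P: its coefficients depend on b alone, and the extra term l = a + 1 that
    -- `suc a` may allow ends at a′ = 0, where `lower` vanishes.
    eval₁-lower : ∀ x a b (h : ℕ → ℕ → Carrierᴹ) →
                  eval₁ x (suc a) b (λ a′ b′ → lower (λ a″ → h a″ b′) a′) ≈ᴹ eval₁ x a b h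
    eval₁-lower x a zero h = ≈ᴹ-trans (eval₁-zeroʳ x (suc a) _) (≈ᴹ-sym (eval₁-zeroʳ x a h))
    eval₁-lower x a (suc b) h =
      ≈ᴹ-trans (eval₁-suc x a b _)
      (≈ᴹ-trans (+ᴹ-congʳ (eval₁-lower x a b (λ a′ b′ → h a′ (suc b′)))) (rest a))
      where
      rest : ∀ a → eval₁ x a b (λ a′ b′ → h a′ (suc b′))
                   +ᴹ x *ₗ eval₁ x a b (λ a′ b′ → lower (λ a″ → h a″ b′) a′) ≈ᴹ eval₁ x a (suc b) h
      rest zero    = begin
        eval₁ x 0 b _ +ᴹ x *ₗ eval₁ x 0 b _
          ≈⟨ +ᴹ-cong (eval₁-zeroˡ x b _) (≈ᴹ-trans (*ₗ-congˡ (eval₁-zeroˡ x b _)) (*ₗ-zeroʳ x)) ⟩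
        h 0 (suc b) +ᴹ 0ᴹ   ≈⟨ +ᴹ-identityʳ _ ⟩
        h 0 (suc b)         ≈⟨ eval₁-zeroˡ x (suc b) h ⟨
        eval₁ x 0 (suc b) h ∎
      rest (suc a) = ≈ᴹ-trans (+ᴹ-congˡ (*ₗ-congˡ (eval₁-lower x a b h))) (≈ᴹ-sym (eval₁-suc x a b h))

    -- The shift rule in a form that includes a = 0, as required under a sum in which the lowered
    -- decoration may reach 0.
    eval₁-sucʳ : ∀ x a b k → eval₁ x a (suc b) k ≈ᴹ
                 eval₁ x a b (λ a′ b′ → k a′ (suc b′)) +ᴹ x *ₗ lower (λ a′ → eval₁ x a′ b k) a
    eval₁-sucʳ x zero    b k = ≈ᴹ-trans (eval₁-zeroˡ x (suc b) k)
      (≈ᴹ-sym (≈ᴹ-trans (+ᴹ-cong (eval₁-zeroˡ x b _) (*ₗ-zeroʳ x)) (+ᴹ-identityʳ _)))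
    eval₁-sucʳ x (suc a) b k = eval₁-suc x a b k

    -- Since P commutes with φ, the composite intertwines S with S + (x + y) P. The two P-terms are
    -- multiples of the same `Z` and cancel, whatever `Z` is.
    eval₁-inverse : ∀ {x y} → x + y ≈ 0# → ∀ a b k →
                    eval₁ x a b (λ a′ b′ → eval₁ y a′ b′ k) ≈ᴹ k a b
    eval₁-inverse {x} {y} x+y≈0 a       zero    k = ≈ᴹ-trans (eval₁-zeroʳ x a _) (eval₁-zeroʳ y a k)
    eval₁-inverse {x} {y} x+y≈0 zero    (suc b) k = ≈ᴹ-trans (eval₁-zeroˡ x (suc b) _) (eval₁-zeroˡ y (suc b) k)
    eval₁-inverse {x} {y} x+y≈0 (suc a) (suc b) k = begin
      eval₁ x (suc a) (suc b) (λ a′ b′ → eval₁ y a′ b′ k)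
        ≈⟨ eval₁-suc x a b _ ⟩
      eval₁ x (suc a) b (λ a′ b′ → eval₁ y a′ (suc b′) k) +ᴹ x *ₗ Z
        ≈⟨ +ᴹ-congʳ (≈ᴹ-trans (eval₁-cong x (suc a) b (λ a′ b′ → eval₁-sucʳ y a′ b′ k)) (eval₁-+ x (suc a) b _ _)) ⟩
      (eval₁ x (suc a) b (λ a′ b′ → eval₁ y a′ b′ kS)
        +ᴹ eval₁ x (suc a) b (λ a′ b′ → y *ₗ lower (λ a″ → eval₁ y a″ b′ k) a′)) +ᴹ x *ₗ Z
        ≈⟨ +ᴹ-congʳ (+ᴹ-cong (eval₁-inverse x+y≈0 (suc a) b kS)
             (≈ᴹ-trans (eval₁-* x (suc a) b y _) (*ₗ-congˡ (eval₁-lower x a b _)))) ⟩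
      (k (suc a) (suc b) +ᴹ y *ₗ Z) +ᴹ x *ₗ Z
        ≈⟨ ≈ᴹ-trans (+ᴹ-assoc _ _ _) (+ᴹ-congˡ (≈ᴹ-sym (*ₗ-distribʳ Z y x))) ⟩
      k (suc a) (suc b) +ᴹ (y + x) *ₗ Z
        ≈⟨ +ᴹ-congˡ (≈ᴹ-trans (*ₗ-congʳ (trans (+-comm y x) x+y≈0)) (*ₗ-zeroˡ Z)) ⟩
      k (suc a) (suc b) +ᴹ 0ᴹ
        ≈⟨ +ᴹ-identityʳ _ ⟩
      k (suc a) (suc b) ∎
      where
      kS : ℕ → ℕ → Carrierᴹ
      kS a′ b′ = k a′ (suc b′)
      Z : Carrierᴹ
      Z = eval₁ x a b (λ a′ b′ → eval₁ y a′ b′ k)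

  -- All coordinates of the multi-index

  module _ (d : ℕ) where

    -- The formula of `φ^` at arbitrary length, so that coordinates can be split off one at a time.
    φₙ : ∀ {n} → Vec Carrier n → Vec ℕ n × Vec ℕ n → Lin K (Vec ℕ n × Vec ℕ n)
    φₙ xs (a , b) = List.map
      (λ l → (Vec.foldr _ _*_ 1# (Vec.zipWith (powK K) xs l)
                * natK K (Vec.foldr _ ℕ._*_ 1 (Vec.zipWith _C_ b l))
             , (Vec.zipWith _∸_ a l , Vec.zipWith _∸_ b l)))
      (box K d (Vec.zipWith _⊓_ a b))

    module _ {m ℓm : Level} (M : Mod m ℓm) where
      open Module M
      open SetoidReasoning ≈ᴹ-setoid

      opaque
        unfolding eval₁

        evalₙ : ∀ {n} → Vec Carrier n → Vec ℕ n → Vec ℕ n → (Vec ℕ n → Vec ℕ n → Carrierᴹ) → Carrierᴹ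
        evalₙ xs a b k = eval M (λ p → k (proj₁ p) (proj₂ p)) (φₙ xs (a , b))

        evalₙ-[] : ∀ k → evalₙ [] [] [] k ≈ᴹ k [] []
        evalₙ-[] k = ≈ᴹ-trans (+ᴹ-identityʳ _)
          (≈ᴹ-trans (*ₗ-congʳ (trans (*-identityˡ _) (+-identityʳ 1#))) (*ₗ-identityˡ _))

        -- φ^λ is a tensor product of one-coordinate maps: `box` is a product of intervals and the
        -- weights are multiplicative, where `natK-*` is needed because the binomials are multiplied
        -- in ℕ.
        evalₙ-∷ : ∀ {n} x (xs : Vec Carrier n) a as b bs k →
          evalₙ (x ∷ xs) (a ∷ as) (b ∷ bs) k ≈ᴹ
          eval₁ M x a b (λ a′ b′ → evalₙ xs as bs (λ as′ bs′ → k (a′ ∷ as′) (b′ ∷ bs′)))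
        evalₙ-∷ {n} x xs a as b bs k = outer (upTo (suc (a ⊓ b)))
          where
          ls : List (Vec ℕ n)
          ls = box K d (Vec.zipWith _⊓_ as bs)
          term : Vec ℕ (suc n) → Carrier × (Vec ℕ (suc n) × Vec ℕ (suc n))
          term l = (Vec.foldr _ _*_ 1# (Vec.zipWith (powK K) (x ∷ xs) l)
                      * natK K (Vec.foldr _ ℕ._*_ 1 (Vec.zipWith _C_ (b ∷ bs) l))
                   , (Vec.zipWith _∸_ (a ∷ as) l , Vec.zipWith _∸_ (b ∷ bs) l))
          term′ : Vec ℕ n → Carrier × (Vec ℕ n × Vec ℕ n)
          term′ l = (Vec.foldr _ _*_ 1# (Vec.zipWith (powK K) xs l)
                       * natK K (Vec.foldr _ ℕ._*_ 1 (Vec.zipWith _C_ bs l))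
                    , (Vec.zipWith _∸_ as l , Vec.zipWith _∸_ bs l))
          k′ : ℕ → Vec ℕ n × Vec ℕ n → Carrierᴹ
          k′ i p = k ((a ∸ i) ∷ proj₁ p) ((b ∸ i) ∷ proj₂ p)
          coeff : ∀ u p u′ q → (u * p) * natK K (u′ ℕ.* q) ≈ (u * natK K u′) * (p * natK K q)
          coeff u p u′ q = trans (*-congˡ (natK-* u′ q))
            (CommSemigroup.interchange *-commutativeSemigroup u p (natK K u′) (natK K q))
          inner : ∀ i ls →
            eval M (λ p → k (proj₁ p) (proj₂ p)) (List.map term (List.map (i ∷_) ls)) ≈ᴹ
            (powK K x i * natK K (b C i)) *ₗ eval M (k′ i) (List.map term′ ls)
          inner i []       = ≈ᴹ-sym (*ₗ-zeroʳ _)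
          inner i (l ∷ ls) = ≈ᴹ-trans
            (+ᴹ-cong (≈ᴹ-trans (*ₗ-congʳ (coeff _ _ (b C i) _)) (*ₗ-assoc _ _ _)) (inner i ls))
            (≈ᴹ-sym (*ₗ-distribˡ _ _ _))
          outer : ∀ is →
            eval M (λ p → k (proj₁ p) (proj₂ p)) (List.map term (List.concatMap (λ i → List.map (i ∷_) ls) is)) ≈ᴹ
            eval M (λ p → evalₙ xs as bs (λ as′ bs′ → k (proj₁ p ∷ as′) (proj₂ p ∷ bs′)))
              (List.map (λ l → (powK K x l * natK K (b C l) , (a ∸ l , b ∸ l))) is)
          outer []       = ≈ᴹ-refl
          outer (i ∷ is)
            rewrite List.map-++ term (List.map (i ∷_) ls) (List.concatMap (λ i → List.map (i ∷_) ls) is) =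
            ≈ᴹ-trans (eval-++ M _ (List.map term (List.map (i ∷_) ls)) _) (+ᴹ-cong (inner i ls) (outer is))

        evalₙ-cong : ∀ {n} xs a b {k k′ : Vec ℕ n → Vec ℕ n → Carrierᴹ} → (∀ a b → k a b ≈ᴹ k′ a b) →
                     evalₙ xs a b k ≈ᴹ evalₙ xs a b k′
        evalₙ-cong xs a b k≈ = eval-cong M (λ _ → k≈ _ _) (φₙ xs (a , b))

      opaque
        unfolding eval₁ evalₙ
        eval₁-evalₙ : ∀ {n} x a b (xs : Vec Carrier n) as bs (k : ℕ → ℕ → Vec ℕ n → Vec ℕ n → Carrierᴹ) →
          eval₁ M x a b (λ a′ b′ → evalₙ xs as bs (k a′ b′)) ≈ᴹ
          evalₙ xs as bs (λ as′ bs′ → eval₁ M x a b (λ a′ b′ → k a′ b′ as′ bs′))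
        eval₁-evalₙ x a b xs as bs k =
          eval-comm M (λ p q → k (proj₁ p) (proj₂ p) (proj₁ q) (proj₂ q)) (φ₁ x (a , b)) (φₙ xs (as , bs))

      evalₙ-compatible : ∀ {n} (xs ys : Vec Carrier n) a c b (k : Vec ℕ n → Vec ℕ n → Vec ℕ n → Carrierᴹ) →
        evalₙ xs a b (λ a′ b₁ → evalₙ ys c b₁ (λ c′ b₂ → k a′ c′ b₂)) ≈ᴹ
        evalₙ ys c b (λ c′ b₁ → evalₙ xs a b₁ (λ a′ b₂ → k a′ c′ b₂))
      evalₙ-compatible [] [] [] [] [] k =
        ≈ᴹ-trans (≈ᴹ-trans (evalₙ-[] _) (evalₙ-[] _)) (≈ᴹ-sym (≈ᴹ-trans (evalₙ-[] _) (evalₙ-[] _)))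
      evalₙ-compatible (x ∷ xs) (y ∷ ys) (a ∷ as) (c ∷ cs) (b ∷ bs) k = begin
        evalₙ (x ∷ xs) (a ∷ as) (b ∷ bs) (λ a′ b₁ → evalₙ (y ∷ ys) (c ∷ cs) b₁ (k a′))
          ≈⟨ separate x xs y ys a as c cs k ⟩
        eval₁ M x a b (λ a′ b₁ → eval₁ M y c b₁ (λ c′ b₂ →
          evalₙ xs as bs (λ as′ bs₁ → evalₙ ys cs bs₁ (λ cs′ bs₂ → k (a′ ∷ as′) (c′ ∷ cs′) (b₂ ∷ bs₂)))))
          ≈⟨ eval₁-compatible M x y a c b _ ⟩
        eval₁ M y c b (λ c′ b₁ → eval₁ M x a b₁ (λ a′ b₂ →
          evalₙ xs as bs (λ as′ bs₁ → evalₙ ys cs bs₁ (λ cs′ bs₂ → k (a′ ∷ as′) (c′ ∷ cs′) (b₂ ∷ bs₂)))))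
          ≈⟨ eval₁-cong M y c b (λ c′ b₁ → eval₁-cong M x a b₁ (λ a′ b₂ →
               evalₙ-compatible xs ys as cs bs _)) ⟩
        eval₁ M y c b (λ c′ b₁ → eval₁ M x a b₁ (λ a′ b₂ →
          evalₙ ys cs bs (λ cs′ bs₁ → evalₙ xs as bs₁ (λ as′ bs₂ → k (a′ ∷ as′) (c′ ∷ cs′) (b₂ ∷ bs₂)))))
          ≈⟨ separate y ys x xs c cs a as (λ c′ a′ → k a′ c′) ⟨
        evalₙ (y ∷ ys) (c ∷ cs) (b ∷ bs) (λ c′ b₁ → evalₙ (x ∷ xs) (a ∷ as) b₁ (λ a′ → k a′ c′)) ∎
        where
        separate : ∀ x xs y ys a as c cs k →
          evalₙ (x ∷ xs) (a ∷ as) (b ∷ bs) (λ a′ b₁ → evalₙ (y ∷ ys) (c ∷ cs) b₁ (k a′)) ≈ᴹ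
          eval₁ M x a b (λ a′ b₁ → eval₁ M y c b₁ (λ c′ b₂ →
            evalₙ xs as bs (λ as′ bs₁ → evalₙ ys cs bs₁ (λ cs′ bs₂ → k (a′ ∷ as′) (c′ ∷ cs′) (b₂ ∷ bs₂)))))
        separate x xs y ys a as c cs k =
          ≈ᴹ-trans (evalₙ-∷ x xs a as b bs _) (eval₁-cong M x a b (λ a′ b₁ →
          ≈ᴹ-trans (evalₙ-cong xs as bs (λ as′ bs₁ → evalₙ-∷ y ys c cs b₁ bs₁ _))
          (≈ᴹ-sym (eval₁-evalₙ y c b₁ xs as bs (λ c′ b₂ as′ bs₁ →
            evalₙ ys cs bs₁ (λ cs′ bs₂ → k (a′ ∷ as′) (c′ ∷ cs′) (b₂ ∷ bs₂)))))))

      evalₙ-inverse : ∀ {n} {xs ys : Vec Carrier n} → Pointwise (λ x y → x + y ≈ 0#) xs ys → ∀ a b k →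
                      evalₙ xs a b (λ a′ b′ → evalₙ ys a′ b′ k) ≈ᴹ k a b
      evalₙ-inverse [] [] [] k = ≈ᴹ-trans (evalₙ-[] _) (evalₙ-[] k)
      evalₙ-inverse {xs = x ∷ xs} {y ∷ ys} (e ∷ es) (a ∷ as) (b ∷ bs) k = begin
        evalₙ (x ∷ xs) (a ∷ as) (b ∷ bs) (λ a′ b′ → evalₙ (y ∷ ys) a′ b′ k)
          ≈⟨ evalₙ-∷ x xs a as b bs _ ⟩
        eval₁ M x a b (λ a′ b′ → evalₙ xs as bs (λ as′ bs′ → evalₙ (y ∷ ys) (a′ ∷ as′) (b′ ∷ bs′) k))
          ≈⟨ eval₁-cong M x a b (λ a′ b′ → evalₙ-cong xs as bs (λ as′ bs′ → evalₙ-∷ y ys a′ as′ b′ bs′ k)) ⟩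
        eval₁ M x a b (λ a′ b′ → evalₙ xs as bs (λ as′ bs′ → eval₁ M y a′ b′ (λ a″ b″ →
          evalₙ ys as′ bs′ (λ as″ bs″ → k (a″ ∷ as″) (b″ ∷ bs″)))))
          ≈⟨ eval₁-cong M x a b (λ a′ b′ → ≈ᴹ-sym (eval₁-evalₙ y a′ b′ xs as bs _)) ⟩
        eval₁ M x a b (λ a′ b′ → eval₁ M y a′ b′ (λ a″ b″ → evalₙ xs as bs (λ as′ bs′ →
          evalₙ ys as′ bs′ (λ as″ bs″ → k (a″ ∷ as″) (b″ ∷ bs″)))))
          ≈⟨ eval₁-inverse M e a b _ ⟩
        evalₙ xs as bs (λ as′ bs′ → evalₙ ys as′ bs′ (λ as″ bs″ → k (a ∷ as″) (b ∷ bs″)))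
          ≈⟨ evalₙ-inverse es as bs _ ⟩
        k (a ∷ as) (b ∷ bs) ∎

-- Multilinear grafting onto a root

module Trees {c ℓ : Level} (K : Field c ℓ) (d : ℕ) where
  open LinearAlgebra K

  Index : Set
  Index = NI K d

  T : Set
  T = Tree K d

  Forest : Set
  Forest = List (Index × T)

  open Derivations K Index

  infix 4 _≃_ _≃ᶠ_

  _≃_ : T → T → Set
  _≃_ = _≅_ K d

  _≃ᶠ_ : Forest → Forest → Set
  _≃ᶠ_ = ChildrenIso K d

  𝕋 : Mod c (c ⊔ ℓ)
  𝕋 = free _≃_

  Endomorphism : Set c
  Endomorphism = Endo K d

  Tree-induction : ∀ {p} (P : T → Set p) → (∀ b cs → All (P ∘ proj₂) cs → P (node b cs)) → ∀ t → P t
  Tree-induction P step (node b cs) = step b cs (children cs)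
    where
    children : ∀ cs → All (P ∘ proj₂) cs
    children []             = []
    children ((a , t) ∷ cs) = Tree-induction P step t ∷ children cs

  mutual
    ≃-refl : ∀ t → t ≃ t
    ≃-refl (node b cs) = node≅ ≡.refl (≃ᶠ-refl cs)

    ≃ᶠ-refl : ∀ cs → cs ≃ᶠ cs
    ≃ᶠ-refl []             = nil
    ≃ᶠ-refl ((a , t) ∷ cs) = cons {ds = []} ≡.refl (≃-refl t) (≃ᶠ-refl cs)

  ≃ᶠ-∷ : ∀ {a s t cs ds} → s ≃ t → cs ≃ᶠ ds → ((a , s) ∷ cs) ≃ᶠ ((a , t) ∷ ds)
  ≃ᶠ-∷ s≃t cs≃ds = cons {ds = []} ≡.refl s≃t cs≃ds

  ≃ᶠ-move : ∀ p cs ds → (p ∷ cs ++ ds) ≃ᶠ (cs ++ p ∷ ds)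
  ≃ᶠ-move p cs ds = cons ≡.refl (≃-refl _) (≃ᶠ-refl _)

  tree : Index → Forest → Lin K T
  tree b cs = single K (node b cs)

  tree-cong : ∀ b {cs ds} → cs ≃ᶠ ds → LinEq K _≃_ (tree b cs) (tree b ds)
  tree-cong b e = lbasis (node≅ ≡.refl e)

  mapᶠ : ∀ {m} {M : Set m} → (T → M) → Forest → List (Index × M)
  mapᶠ g = List.map (map₂ g)

  module _ {m ℓm : Level} (M : Mod m ℓm) where
    open Module M

    -- The common source of well-definedness on isomorphism classes for `θ` and for `extend`.
    module Recursive (g : T → Carrierᴹ) (k : Index → List (Index × Carrierᴹ) → Carrierᴹ)
                     (g-node : ∀ b cs → g (node b cs) ≈ᴹ k b (mapᶠ g cs))
                     (k-symmetric : ∀ b → Symmetric M M (k b)) where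

      mutual
        g-cong : ∀ {s t} → s ≃ t → g s ≈ᴹ g t
        g-cong (node≅ {b = b} {cs = cs} {cs' = ds} ≡.refl e) =
          ≈ᴹ-trans (g-node b cs) (≈ᴹ-trans (k-symmetric b (mapᶠ-cong e)) (≈ᴹ-sym (g-node b ds)))

        mapᶠ-cong : ∀ {cs ds} → cs ≃ᶠ ds → _∼_ M (mapᶠ g cs) (mapᶠ g ds)
        mapᶠ-cong nil = nil
        mapᶠ-cong (cons {a = a} {t' = t} {ds = ds} {ds' = ds′} ≡.refl s≃t e) =
          comp (skip (g-cong s≃t) (mapᶠ-cong e)) (moved ds)
          where
          moved : ∀ ds → _∼_ M ((a , g t) ∷ mapᶠ g (ds ++ ds′)) (mapᶠ g (ds ++ (a , t) ∷ ds′))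
          moved ds rewrite List.map-++ (map₂ g) ds ds′ | List.map-++ (map₂ g) ds ((a , t) ∷ ds′) =
            ∼-move M (a , g t) (mapᶠ g ds) (mapᶠ g ds′)

  module Gather {n ℓn : Level} (N : Mod n ℓn) where
    open Module N
    open SetoidReasoning ≈ᴹ-setoid

    -- Commutation of φ₁₃ with ψ₂₃ on a ⊗ c ⊗ b, tested against `k`. With φ = ψ it is
    -- tree-compatibility; different φ and ψ occur when Θ_ψ is composed with Θ_φ.
    Compatible : Endomorphism → Endomorphism → Set _
    Compatible φ ψ = ∀ a c b (k : Index → Index → Index → Carrierᴹ) →
      eval N (λ p → eval N (λ q → k (proj₁ p) (proj₁ q) (proj₂ q)) (ψ (c , proj₂ p))) (φ (a , b)) ≈ᴹ
      eval N (λ q → eval N (λ p → k (proj₁ p) (proj₁ q) (proj₂ p)) (φ (a , proj₂ q))) (ψ (c , b))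

    Inverse : Endomorphism → Endomorphism → Set _
    Inverse φ ψ = ∀ a b (k : Index → Index → Carrierᴹ) →
      eval N (λ p → eval N (λ q → k (proj₁ q) (proj₂ q)) (ψ p)) (φ (a , b)) ≈ᴹ k a b

    idφ-compatible : Compatible (idφ K d) (idφ K d)
    idφ-compatible a c b k = ≈ᴹ-trans
      (≈ᴹ-trans (eval-single N (λ p → eval N (λ q → k (proj₁ p) (proj₁ q) (proj₂ q)) (single K (c , proj₂ p))) (a , b))
                (eval-single N (λ q → k a (proj₁ q) (proj₂ q)) (c , b)))
      (≈ᴹ-sym (≈ᴹ-trans
        (eval-single N (λ q → eval N (λ p → k (proj₁ p) (proj₁ q) (proj₂ p)) (single K (a , proj₂ q))) (c , b))
        (eval-single N (λ p → k (proj₁ p) c (proj₂ p)) (a , b))))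

    Invariant : (Forest → Carrierᴹ) → Set _
    Invariant k = ∀ {cs ds} → cs ≃ᶠ ds → k cs ≈ᴹ k ds

    Invariant-∷ : ∀ {k} → Invariant k → ∀ p → Invariant (λ cs → k (p ∷ cs))
    Invariant-∷ ik p e = ik (≃ᶠ-∷ (≃-refl _) e)

    -- Serves the constructor `cons` of `ChildrenIso`, which inserts a child at an arbitrary
    -- position.
    ∂ᵇ-move : ∀ D k → Invariant k → ∀ p cs ds →
              ∂ᵇ N D k (p ∷ cs ++ ds) ≈ᴹ ∂ᵇ N D k (cs ++ p ∷ ds)
    ∂ᵇ-move D k ik p             []             ds = ≈ᴹ-refl
    ∂ᵇ-move D k ik p@(a , s) (q@(e , t) ∷ cs) ds = begin
      eval N (λ z → k ((a , z) ∷ q ∷ cs ++ ds)) (D s) +ᴹ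
        (eval N (λ z → k (p ∷ (e , z) ∷ cs ++ ds)) (D t) +ᴹ ∂ᵇ N D (λ zs → k (p ∷ q ∷ zs)) (cs ++ ds))
        ≈⟨ ≈ᴹ-trans (≈ᴹ-sym (+ᴹ-assoc _ _ _)) (≈ᴹ-trans (+ᴹ-congʳ (+ᴹ-comm _ _)) (+ᴹ-assoc _ _ _)) ⟩
      eval N (λ z → k (p ∷ (e , z) ∷ cs ++ ds)) (D t) +ᴹ
        (eval N (λ z → k ((a , z) ∷ q ∷ cs ++ ds)) (D s) +ᴹ ∂ᵇ N D (λ zs → k (p ∷ q ∷ zs)) (cs ++ ds))
        ≈⟨ +ᴹ-cong (eval-cong N (λ z → ik (≃ᶠ-move p ((e , z) ∷ cs) ds)) (D t))
             (+ᴹ-cong (eval-cong N (λ z → ik (swap₂ (a , z))) (D s))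
                      (∂ᵇ-cong N D (cs ++ ds) (λ zs _ → ik (≃ᶠ-move p (q ∷ []) zs)))) ⟩
      eval N (λ z → k ((e , z) ∷ cs ++ p ∷ ds)) (D t) +ᴹ ∂ᵇ N D (λ zs → k (q ∷ zs)) (p ∷ cs ++ ds)
        ≈⟨ +ᴹ-congˡ (∂ᵇ-move D (λ zs → k (q ∷ zs)) (Invariant-∷ ik q) p cs ds) ⟩
      eval N (λ z → k ((e , z) ∷ cs ++ p ∷ ds)) (D t) +ᴹ ∂ᵇ N D (λ zs → k (q ∷ zs)) (cs ++ p ∷ ds) ∎
      where
      swap₂ : ∀ r → (r ∷ q ∷ cs ++ ds) ≃ᶠ (q ∷ r ∷ cs ++ ds)
      swap₂ r = ≃ᶠ-move r (q ∷ []) (cs ++ ds)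

    -- What θ does at a root with decoration b, but multilinear in the branches, and with a
    -- continuation k in place of `node`.
    gather : Endomorphism → Index → List (Index × Lin K T) → (Index → Forest → Carrierᴹ) → Carrierᴹ
    gather φ b []             k = k b []
    gather φ b ((a , y) ∷ ys) k =
      eval N (λ p → eval N (λ t → gather φ (proj₂ p) ys (λ b′ cs → k b′ ((proj₁ p , t) ∷ cs))) y) (φ (a , b))

    module _ (φ : Endomorphism) where

      gather-cong : ∀ b ys {k k′} → (∀ b cs → k b cs ≈ᴹ k′ b cs) → gather φ b ys k ≈ᴹ gather φ b ys k′
      gather-cong b []             k≈ = k≈ b []
      gather-cong b ((a , y) ∷ ys) k≈ =
        eval-cong N (λ p → eval-cong N (λ t → gather-cong (proj₂ p) ys (λ b′ cs → k≈ b′ _)) y) (φ (a , b))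

      gather-+ : ∀ b ys k k′ → gather φ b ys (λ b cs → k b cs +ᴹ k′ b cs) ≈ᴹ gather φ b ys k +ᴹ gather φ b ys k′
      gather-+ b []             k k′ = ≈ᴹ-refl
      gather-+ b ((a , y) ∷ ys) k k′ = ≈ᴹ-trans
        (eval-cong N (λ p → ≈ᴹ-trans (eval-cong N (λ t → gather-+ (proj₂ p) ys _ _) y) (eval-+ N _ _ y)) (φ (a , b)))
        (eval-+ N _ _ (φ (a , b)))

      gather-eval : {X : Set} → ∀ b ys (k : X → Index → Forest → Carrierᴹ) xs →
        gather φ b ys (λ b cs → eval N (λ x → k x b cs) xs) ≈ᴹ eval N (λ x → gather φ b ys (k x)) xs
      gather-eval b []             k xs = ≈ᴹ-refl
      gather-eval b ((a , y) ∷ ys) k xs = ≈ᴹ-trans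
        (eval-cong N (λ p → ≈ᴹ-trans
          (eval-cong N (λ t → gather-eval (proj₂ p) ys (λ x b′ cs → k x b′ ((proj₁ p , t) ∷ cs)) xs) y)
          (eval-comm N (λ t x → gather φ (proj₂ p) ys (λ b′ cs → k x b′ ((proj₁ p , t) ∷ cs))) y xs)) (φ (a , b)))
        (eval-comm N (λ p x → eval N (λ t → gather φ (proj₂ p) ys (λ b′ cs → k x b′ ((proj₁ p , t) ∷ cs))) y)
          (φ (a , b)) xs)

      gather-linear : ∀ b k → (∀ b → Invariant (k b)) → Multilinear 𝕋 N (λ ys → gather φ b ys k)
      gather-linear b k ik [] a ys =
        eval-linearʳ 𝕋 N (λ p y → eval N (λ t → gather φ (proj₂ p) ys (λ b′ cs → k b′ ((proj₁ p , t) ∷ cs))) y)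
          (λ p → eval-linear N _ _≃_
            (λ s≃t → gather-cong (proj₂ p) ys (λ b′ cs → ik b′ (≃ᶠ-∷ s≃t (≃ᶠ-refl cs))))) (φ (a , b))
      gather-linear b k ik ((e , x) ∷ xs) a ys =
        eval-linearʳ 𝕋 N _ (λ p → eval-linearʳ 𝕋 N _ (λ t →
          gather-linear (proj₂ p) (λ b′ cs → k b′ ((proj₁ p , t) ∷ cs)) (λ b′ → Invariant-∷ (ik b′) _) xs a ys) x)
          (φ (e , b))

      -- `φ` touches only the decorations of the root and its edges, so a derivation of the branches
      -- may act before or after it.
      gather-∂ : ∀ D b ys (k : Index → Forest → Carrierᴹ) →
                 gather φ b ys (λ b cs → ∂ᵇ N D (k b) cs) ≈ᴹ ∂ N (bind K D) (λ zs → gather φ b zs k) ys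
      gather-∂ D b []             k = ≈ᴹ-refl
      gather-∂ D b ((a , y) ∷ ys) k = begin
        eval N (λ p → eval N (λ t → gather φ (proj₂ p) ys (λ b′ cs →
          eval N (λ z → k b′ ((proj₁ p , z) ∷ cs)) (D t) +ᴹ ∂ᵇ N D (λ zs → k b′ ((proj₁ p , t) ∷ zs)) cs)) y) (φ (a , b))
          ≈⟨ eval-cong N (λ p → eval-cong N (λ t → ≈ᴹ-trans (gather-+ (proj₂ p) ys _ _)
               (+ᴹ-cong (gather-eval (proj₂ p) ys (λ z b′ cs → k b′ ((proj₁ p , z) ∷ cs)) (D t))
                        (gather-∂ D (proj₂ p) ys (λ b′ cs → k b′ ((proj₁ p , t) ∷ cs))))) y) (φ (a , b)) ⟩
        eval N (λ p → eval N (λ t → eval N (h p) (D t) +ᴹ ∂ N (bind K D) (λ zs → h′ zs p t) ys) y) (φ (a , b))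
          ≈⟨ eval-cong N (λ p → ≈ᴹ-trans (eval-+ N _ _ y) (+ᴹ-cong (≈ᴹ-sym (eval-bind N (h p) D y))
               (∂-eval N (bind K D) (λ t zs → h′ zs p t) y ys))) (φ (a , b)) ⟩
        eval N (λ p → eval N (h p) (bind K D y) +ᴹ ∂ N (bind K D) (λ zs → eval N (h′ zs p) y) ys) (φ (a , b))
          ≈⟨ ≈ᴹ-trans (eval-+ N _ _ (φ (a , b)))
               (+ᴹ-congˡ (∂-eval N (bind K D) (λ p zs → eval N (h′ zs p) y) (φ (a , b)) ys)) ⟩
        gather φ b ((a , bind K D y) ∷ ys) k +ᴹ ∂ N (bind K D) (λ zs → gather φ b ((a , y) ∷ zs) k) ys ∎
        where
        h′ : List (Index × Lin K T) → Index × Index → T → Carrierᴹ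
        h′ zs p t = gather φ (proj₂ p) zs (λ b′ cs → k b′ ((proj₁ p , t) ∷ cs))
        h : Index × Index → T → Carrierᴹ
        h = h′ ys

    module _ (φ ψ : Endomorphism) (compatible : Compatible φ ψ) where

      -- Compatibility lets the factor ψ of a further edge be applied before instead of after gathering.
      gather-compatible : ∀ a b ys (h : Index → Index → Forest → Carrierᴹ) →
        gather φ b ys (λ b′ cs → eval N (λ p → h (proj₁ p) (proj₂ p) cs) (ψ (a , b′))) ≈ᴹ
        eval N (λ p → gather φ (proj₂ p) ys (h (proj₁ p))) (ψ (a , b))
      gather-compatible a b []             h = ≈ᴹ-refl
      gather-compatible a b ((c , y) ∷ ys) h = begin
        eval N (λ q → eval N (λ t → gather φ (proj₂ q) ys (λ b′ cs →
          eval N (λ p → h (proj₁ p) (proj₂ p) ((proj₁ q , t) ∷ cs)) (ψ (a , b′)))) y) (φ (c , b))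
          ≈⟨ eval-cong N (λ q → eval-cong N (λ t →
               gather-compatible a (proj₂ q) ys (λ a′ b′ cs → h a′ b′ ((proj₁ q , t) ∷ cs))) y) (φ (c , b)) ⟩
        eval N (λ q → eval N (λ t → eval N (λ p → G (proj₁ q) (proj₁ p) (proj₂ p) t) (ψ (a , proj₂ q))) y) (φ (c , b))
          ≈⟨ eval-cong N (λ q → eval-comm N (λ t p → G (proj₁ q) (proj₁ p) (proj₂ p) t) y (ψ (a , proj₂ q))) (φ (c , b)) ⟩
        eval N (λ q → eval N (λ p → eval N (G (proj₁ q) (proj₁ p) (proj₂ p)) y) (ψ (a , proj₂ q))) (φ (c , b))
          ≈⟨ compatible c a b (λ c′ a′ b′ → eval N (G c′ a′ b′) y) ⟩
        eval N (λ p → gather φ (proj₂ p) ((c , y) ∷ ys) (h (proj₁ p))) (ψ (a , b)) ∎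
        where
        G : Index → Index → Index → T → Carrierᴹ
        G c′ a′ b′ t = gather φ b′ ys (λ b″ cs → h a′ b″ ((c′ , t) ∷ cs))

      -- Compatibility moves the ψ of each edge past the φ of all later edges until it meets the φ
      -- of its own edge and cancels; only `g` on the branches survives.
      gather-inverse : Inverse φ ψ → ∀ (g : T → Lin K T) b ys k →
        gather φ b ys (λ b′ cs → gather ψ b′ (mapᶠ g cs) k) ≈ᴹ
        gather (idφ K d) b (List.map (map₂ (bind K g)) ys) k
      gather-inverse inverse g b []             k = ≈ᴹ-refl
      gather-inverse inverse g b ((a , y) ∷ ys) k = begin
        eval N (λ p → eval N (λ t → gather φ (proj₂ p) ys (λ b′ cs →
          eval N (λ q → inner (proj₁ q) (proj₂ q) t cs) (ψ (proj₁ p , b′)))) y) (φ (a , b))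
          ≈⟨ eval-cong N (λ p → ≈ᴹ-trans (eval-cong N (λ t →
               gather-compatible (proj₁ p) (proj₂ p) ys (λ a′ b′ cs → inner a′ b′ t cs)) y)
               (eval-comm N (λ t q → gather φ (proj₂ q) ys (λ b′ cs → inner (proj₁ q) b′ t cs)) y (ψ p))) (φ (a , b)) ⟩
        eval N (λ p → eval N (λ q → eval N (λ t → gather φ (proj₂ q) ys (λ b′ cs → inner (proj₁ q) b′ t cs)) y)
          (ψ p)) (φ (a , b))
          ≈⟨ inverse a b (λ a′ b′ → eval N (λ t → gather φ b′ ys (λ b″ cs → inner a′ b″ t cs)) y) ⟩
        eval N (λ t → gather φ b ys (λ b′ cs → inner a b′ t cs)) y
          ≈⟨ eval-cong N (λ t → ≈ᴹ-trans
               (gather-eval φ b ys (λ t′ b′ cs → gather ψ b′ (mapᶠ g cs) (λ b″ ds → k b″ ((a , t′) ∷ ds))) (g t))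
               (eval-cong N (λ t′ → gather-inverse inverse g b ys (λ b″ ds → k b″ ((a , t′) ∷ ds))) (g t))) y ⟩
        eval N (λ t → eval N last (g t)) y   ≈⟨ eval-bind N last g y ⟨
        eval N last (bind K g y)             ≈⟨ eval-single N (λ p → eval N (λ t → gather (idφ K d) (proj₂ p)
                                                    (List.map (map₂ (bind K g)) ys)
                                                    (λ b″ ds → k b″ ((proj₁ p , t) ∷ ds))) (bind K g y)) (a , b) ⟨
        gather (idφ K d) b (List.map (map₂ (bind K g)) ((a , y) ∷ ys)) k ∎
        where
        inner : Index → Index → T → Forest → Carrierᴹ
        inner a′ b′ t cs = eval N (λ t′ → gather ψ b′ (mapᶠ g cs) (λ b″ ds → k b″ ((a′ , t′) ∷ ds))) (g t)
        last : T → Carrierᴹ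
        last t′ = gather (idφ K d) b (List.map (map₂ (bind K g)) ys) (λ b″ ds → k b″ ((a , t′) ∷ ds))

    -- A transposition exchanges two applications of φ, by compatibility, and two children under
    -- `k`, by invariance.
    gather-symmetric : ∀ φ → Compatible φ φ → ∀ k → (∀ b → Invariant (k b)) →
                       ∀ b → Symmetric 𝕋 N (λ ys → gather φ b ys k)
    gather-symmetric φ compatible k ik b nil = ≈ᴹ-refl
    gather-symmetric φ compatible k ik b (comp e e′) =
      ≈ᴹ-trans (gather-symmetric φ compatible k ik b e) (gather-symmetric φ compatible k ik b e′)
    gather-symmetric φ compatible k ik b (skip {a} {y} {y′} {ys} {ys′} y≈ e) =
      ≈ᴹ-trans (Linear.cong (gather-linear φ b k ik [] a ys) y≈)
        (eval-cong N (λ p → eval-cong N (λ t → gather-symmetric φ compatible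
          (λ b′ cs → k b′ ((proj₁ p , t) ∷ cs)) (λ b′ → Invariant-∷ (ik b′) _) (proj₂ p) e) y′) (φ (a , b)))
    gather-symmetric φ compatible k ik b (swap (a , y) (c , z) ys) = begin
      eval N (λ p → eval N (λ t → eval N (λ q → eval N (G p q t) z) (φ (c , proj₂ p))) y) (φ (a , b))
        ≈⟨ eval-cong N (λ p → eval-comm N (λ t q → eval N (G p q t) z) y (φ (c , proj₂ p))) (φ (a , b)) ⟩
      eval N (λ p → eval N (λ q → eval N (λ t → eval N (G p q t) z) y) (φ (c , proj₂ p))) (φ (a , b))
        ≈⟨ compatible a c b (λ a′ c′ b′ → eval N (λ t → eval N (G (a′ , b′) (c′ , b′) t) z) y) ⟩
      eval N (λ q → eval N (λ p → eval N (λ t → eval N (G p (proj₁ q , proj₂ p) t) z) y) (φ (a , proj₂ q))) (φ (c , b))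
        ≈⟨ eval-cong N (λ q → eval-cong N (λ p → ≈ᴹ-trans (eval-comm N (G p (proj₁ q , proj₂ p)) y z)
             (eval-cong N (λ s → eval-cong N (λ t → gather-cong φ (proj₂ p) ys
               (λ b′ cs → ik b′ (≃ᶠ-move (proj₁ p , t) ((proj₁ q , s) ∷ []) cs))) y) z))
             (φ (a , proj₂ q))) (φ (c , b)) ⟩
      eval N (λ q → eval N (λ p → eval N (λ s → eval N (H p q s) y) z) (φ (a , proj₂ q))) (φ (c , b))
        ≈⟨ eval-cong N (λ q → eval-comm N (λ p s → eval N (H p q s) y) (φ (a , proj₂ q)) z) (φ (c , b)) ⟩
      eval N (λ q → eval N (λ s → eval N (λ p → eval N (H p q s) y) (φ (a , proj₂ q))) z) (φ (c , b)) ∎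
      where
      G H : Index × Index → Index × Index → T → T → Carrierᴹ
      G p q t s = gather φ (proj₂ q) ys (λ b′ cs → k b′ ((proj₁ p , t) ∷ (proj₁ q , s) ∷ cs))
      H p q s t = gather φ (proj₂ p) ys (λ b′ cs → k b′ ((proj₁ q , s) ∷ (proj₁ p , t) ∷ cs))

    gather-single : ∀ b cs k → gather (idφ K d) b (mapᶠ (single K) cs) k ≈ᴹ k b cs
    gather-single b []             k = ≈ᴹ-refl
    gather-single b ((a , t) ∷ cs) k =
      ≈ᴹ-trans (eval-single N (λ p → eval N (G p) (single K t)) (a , b))
        (≈ᴹ-trans (eval-single N (G (a , b)) t) (gather-single b cs (λ b′ ds → k b′ ((a , t) ∷ ds))))
      where
      G : Index × Index → T → Carrierᴹ
      G p t = gather (idφ K d) (proj₂ p) (mapᶠ (single K) cs) (λ b′ ds → k b′ ((proj₁ p , t) ∷ ds))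

    -- `θ` expands all root edges, then all subtrees, and zips the results, whereas `gather`
    -- alternates edge by edge; Fubini converts one order of summation into the other.
    θ-gather : ∀ φ b cs (k : Index → Forest → Carrierᴹ) →
      eval N (λ p → eval N (λ ts → k (proj₁ p) (List.zip (proj₂ p) ts)) (θs K d φ cs))
        (rootPart K d φ b (List.map proj₁ cs)) ≈ᴹ
      gather φ b (mapᶠ (θ K d φ) cs) k
    θ-gather φ b []             k = ≈ᴹ-trans
      (eval-single N (λ p → eval N (λ ts → k (proj₁ p) (List.zip (proj₂ p) ts)) (single K [])) (b , []))
      (eval-single N (λ ts → k b (List.zip [] ts)) [])
    θ-gather φ b ((a , s) ∷ cs) k = begin
      eval N F (bind K (λ p → linMap K (λ q → (proj₁ q , proj₁ p ∷ proj₂ q)) (root (proj₂ p))) (φ (a , b)))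
        ≈⟨ eval-bind N F (λ p → linMap K (λ q → (proj₁ q , proj₁ p ∷ proj₂ q)) (root (proj₂ p))) (φ (a , b)) ⟩
      eval N (λ p → eval N F (linMap K (λ q → (proj₁ q , proj₁ p ∷ proj₂ q)) (root (proj₂ p)))) (φ (a , b))
        ≈⟨ eval-cong N (λ p → eval-linMap N F (λ q → (proj₁ q , proj₁ p ∷ proj₂ q)) (root (proj₂ p))) (φ (a , b)) ⟩
      eval N (λ p → eval N (λ q → F (proj₁ q , proj₁ p ∷ proj₂ q)) (root (proj₂ p))) (φ (a , b))
        ≈⟨ eval-cong N (λ p → eval-cong N (λ q → split (proj₁ p) q) (root (proj₂ p))) (φ (a , b)) ⟩
      eval N (λ p → eval N (λ q → eval N (λ t → eval N (G (proj₁ p) q t) (θs K d φ cs)) (θ K d φ s))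
        (root (proj₂ p))) (φ (a , b))
        ≈⟨ eval-cong N (λ p → eval-comm N (λ q t → eval N (G (proj₁ p) q t) (θs K d φ cs))
             (root (proj₂ p)) (θ K d φ s)) (φ (a , b)) ⟩
      eval N (λ p → eval N (λ t → eval N (λ q → eval N (G (proj₁ p) q t) (θs K d φ cs))
        (root (proj₂ p))) (θ K d φ s)) (φ (a , b))
        ≈⟨ eval-cong N (λ p → eval-cong N (λ t →
             θ-gather φ (proj₂ p) cs (λ b′ ds → k b′ ((proj₁ p , t) ∷ ds))) (θ K d φ s)) (φ (a , b)) ⟩
      gather φ b (mapᶠ (θ K d φ) ((a , s) ∷ cs)) k ∎
      where
      root : Index → Lin K (Index × List Index)
      root b′ = rootPart K d φ b′ (List.map proj₁ cs)
      F : Index × List Index → Carrierᴹ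
      F p = eval N (λ ts → k (proj₁ p) (List.zip (proj₂ p) ts)) (θs K d φ ((a , s) ∷ cs))
      G : Index → Index × List Index → T → List T → Carrierᴹ
      G a′ q t ts = k (proj₁ q) ((a′ , t) ∷ List.zip (proj₂ q) ts)
      split : ∀ a′ q → F (proj₁ q , a′ ∷ proj₂ q) ≈ᴹ
              eval N (λ t → eval N (G a′ q t) (θs K d φ cs)) (θ K d φ s)
      split a′ q = ≈ᴹ-trans
        (eval-bind N (λ ts → k (proj₁ q) (List.zip (a′ ∷ proj₂ q) ts))
          (λ t → bind K (λ ts → single K (t ∷ ts)) (θs K d φ cs)) (θ K d φ s))
        (eval-cong N (λ t → eval-linMap N (λ ts → k (proj₁ q) (List.zip (a′ ∷ proj₂ q) ts))
          (t ∷_) (θs K d φ cs)) (θ K d φ s))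

  module _ {n ℓn p ℓp : Level} (N : Mod n ℓn) (P : Mod p ℓp) where
    private
      module N = Gather N
      module P = Gather P
    open Module P

    gather-apply : ∀ {f} → Linear N P f → ∀ φ b ys k →
                   f (N.gather φ b ys k) ≈ᴹ P.gather φ b ys (λ b′ cs → f (k b′ cs))
    gather-apply lf φ b []             k = ≈ᴹ-refl
    gather-apply lf φ b ((a , y) ∷ ys) k =
      ≈ᴹ-trans (linear-eval N P lf _ (φ (a , b)))
        (eval-cong P (λ p → ≈ᴹ-trans (linear-eval N P lf _ y)
          (eval-cong P (λ t → gather-apply lf φ (proj₂ p) ys _) y)) (φ (a , b)))

-- The products ◁^φ and the map Θ_φ

module Grafting {c ℓ : Level} (K : Field c ℓ) (d : ℕ) where
  open LinearAlgebra K
  open Trees K d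
  open Derivations K Index
  open Gather 𝕋
  open Field K using (*-identityʳ; sym)

  open Module 𝕋
  open SetoidReasoning ≈ᴹ-setoid

  map-eval : {X : Set} (h : X → T) → ∀ xs →
             List.map (λ p → (proj₁ p , h (proj₂ p))) xs ≈ᴹ eval 𝕋 (single K ∘ h) xs
  map-eval h []       = lrefl
  map-eval h (x ∷ xs) = lapp (lcoef (sym (*-identityʳ _))) (map-eval h xs)

  module Product (φ : Endomorphism) where

    -- Separates grafting at the root from grafting inside a branch, and identifies `graftCh`, with
    -- its accumulator of passed siblings, as a derivation.
    graft-node : ∀ a t b cs → graft K d φ a t (node b cs) ≈ᴹ
      eval 𝕋 (λ p → tree (proj₂ p) ((proj₁ p , t) ∷ cs)) (φ (a , b)) +ᴹ ∂ᵇ 𝕋 (graft K d φ a t) (tree b) cs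
    graft-node a t b cs = lapp (map-eval (λ p → node (proj₂ p) ((proj₁ p , t) ∷ cs)) (φ (a , b))) (go [] cs)
      where
      go : ∀ done cs → graftCh K d φ a t b done cs ≈ᴹ
                       ∂ᵇ 𝕋 (graft K d φ a t) (λ ds → tree b (done ++ ds)) cs
      go done []             = lrefl
      go done ((e , s) ∷ cs) = lapp (map-eval (λ z → node b (done ++ (e , z) ∷ cs)) (graft K d φ a t s))
        (ltrans (go (done ++ (e , s) ∷ []) cs) (∂ᵇ-cong 𝕋 (graft K d φ a t) cs
          (λ ds _ → ≈ᴹ-reflexive (≡.cong (tree b) (List.++-assoc done ((e , s) ∷ []) ds)))))

    mutual
      graft-cong : ∀ a {t t′ s s′} → t ≃ t′ → s ≃ s′ → graft K d φ a t s ≈ᴹ graft K d φ a t′ s′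
      graft-cong a {t} {t′} t≃ (node≅ {b = b} {cs = cs} {cs' = ds} ≡.refl e) = begin
        graft K d φ a t (node b cs)  ≈⟨ graft-node a t b cs ⟩
        _                            ≈⟨ lapp (eval-cong 𝕋 (λ p → tree-cong (proj₂ p) (≃ᶠ-∷ t≃ e)) (φ (a , b)))
                                             (∂ᵇ-graft-cong a t≃ (tree b) (tree-cong b) e) ⟩
        _                            ≈⟨ graft-node a t′ b ds ⟨
        graft K d φ a t′ (node b ds) ∎

      ∂ᵇ-graft-cong : ∀ a {t t′} → t ≃ t′ → ∀ k → Invariant k → ∀ {cs ds} → cs ≃ᶠ ds →
                      ∂ᵇ 𝕋 (graft K d φ a t) k cs ≈ᴹ ∂ᵇ 𝕋 (graft K d φ a t′) k ds
      ∂ᵇ-graft-cong a t≃ k ik nil = lrefl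
      ∂ᵇ-graft-cong a {t} {t′} t≃ k ik
        (cons {a = e} {t = s} {t' = s′} {cs = cs} {ds = ds} {ds' = ds′} ≡.refl s≃ cs≃) = begin
        eval 𝕋 (λ z → k ((e , z) ∷ cs)) (graft K d φ a t s) +ᴹ ∂ᵇ 𝕋 (graft K d φ a t) (λ zs → k ((e , s) ∷ zs)) cs
          ≈⟨ lapp (ltrans (eval-cong 𝕋 (λ z → Invariant-∷ ik (e , z) cs≃) (graft K d φ a t s))
                    (eval-resp 𝕋 (λ z → k ((e , z) ∷ ds ++ ds′)) (λ z≃ → ik (≃ᶠ-∷ z≃ (≃ᶠ-refl _)))
                      (graft-cong a t≃ s≃)))
                  (ltrans (∂ᵇ-graft-cong a t≃ (λ zs → k ((e , s) ∷ zs)) (Invariant-∷ ik (e , s)) cs≃)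
                    (∂ᵇ-cong 𝕋 (graft K d φ a t′) (ds ++ ds′) (λ zs _ → ik (≃ᶠ-∷ s≃ (≃ᶠ-refl zs))))) ⟩
        ∂ᵇ 𝕋 (graft K d φ a t′) k ((e , s′) ∷ ds ++ ds′)
          ≈⟨ ∂ᵇ-move (graft K d φ a t′) k ik (e , s′) ds ds′ ⟩
        ∂ᵇ 𝕋 (graft K d φ a t′) k (ds ++ (e , s′) ∷ ds′) ∎

    graftOnto : Index → Lin K T → T → Lin K T
    graftOnto a x s = eval 𝕋 (λ t → graft K d φ a t s) x

    -- The product x ◁_a y for a basis element a, as an operator on y.
    L : Index → Lin K T → Lin K T → Lin K T
    L a x = bind K (graftOnto a x)

    L-linearʳ : ∀ a x → Linear 𝕋 𝕋 (L a x)
    L-linearʳ a x = eval-linear 𝕋 (graftOnto a x) _≃_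
      (λ s≃ → eval-cong 𝕋 (λ t → graft-cong a (≃-refl t) s≃) x)

    L-linearˡ : ∀ a y → Linear 𝕋 𝕋 (λ x → L a x y)
    L-linearˡ a = eval-linearʳ 𝕋 𝕋 (λ s x → graftOnto a x s)
      (λ s → eval-linear 𝕋 (λ t → graft K d φ a t s) _≃_ (λ t≃ → graft-cong a t≃ (≃-refl s)))

    ◁≈L : ∀ x as y → ◁[_] K d φ x as y ≈ᴹ eval 𝕋 (λ a → L a x y) as
    ◁≈L x as y = eval-cong 𝕋 (λ a → eval-comm 𝕋 (graft K d φ a) x y) as

    L-single : ∀ a t s → L a (single K t) (single K s) ≈ᴹ graft K d φ a t s
    L-single a t s = ltrans (eval-single 𝕋 (graftOnto a (single K t)) s)
                            (eval-single 𝕋 (λ t → graft K d φ a t s) t)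

    ◁-cong : ∀ {as as′ x x′ y y′} → LinEq K _≡_ as as′ → x ≈ᴹ x′ → y ≈ᴹ y′ →
             ◁[_] K d φ x as y ≈ᴹ ◁[_] K d φ x′ as′ y′
    ◁-cong {as} {as′} {x} {x′} {y} {y′} as≈ x≈ y≈ = begin
      ◁[_] K d φ x as y            ≈⟨ ◁≈L x as y ⟩
      eval 𝕋 (λ a → L a x y) as    ≈⟨ eval-cong 𝕋 (λ a → ltrans (Linear.cong (L-linearˡ a y) x≈)
                                                                 (Linear.cong (L-linearʳ a x′) y≈)) as ⟩
      eval 𝕋 (λ a → L a x′ y′) as  ≈⟨ eval-resp 𝕋 (λ a → L a x′ y′) {_≡_} (λ { ≡.refl → lrefl }) as≈ ⟩
      eval 𝕋 (λ a → L a x′ y′) as′ ≈⟨ ◁≈L x′ as′ y′ ⟨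
      ◁[_] K d φ x′ as′ y′         ∎

    corolla : Index → List (Index × Lin K T) → Lin K T
    corolla b ys = gather φ b ys tree

    corolla-linear : ∀ b → Multilinear 𝕋 𝕋 (corolla b)
    corolla-linear b = gather-linear φ b tree tree-cong

    θ-node : ∀ b cs → θ K d φ (node b cs) ≈ᴹ corolla b (mapᶠ (θ K d φ) cs)
    θ-node b cs = θ-gather φ b cs tree

    module Compatibility (compatible : Compatible φ φ) where

      corolla-symmetric : ∀ b → Symmetric 𝕋 𝕋 (corolla b)
      corolla-symmetric = gather-symmetric φ compatible tree tree-cong

      θ-cong : ∀ {s t} → s ≃ t → θ K d φ s ≈ᴹ θ K d φ t
      θ-cong = Recursive.g-cong 𝕋 (θ K d φ) corolla θ-node corolla-symmetric

      Θ-linear : Linear 𝕋 𝕋 (Θ K d φ)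
      Θ-linear = eval-linear 𝕋 (θ K d φ) _≃_ θ-cong

      -- Grafting at the root applies φ to the new edge after those of `ys`, while the corolla with
      -- `(a , x)` in front applies it before them; `gather-compatible` reconciles the two.
      L-corolla : ∀ a x b ys → L a x (corolla b ys) ≈ᴹ
                  corolla b ((a , x) ∷ ys) +ᴹ ∂ 𝕋 (L a x) (corolla b) ys
      L-corolla a x b ys = begin
        L a x (corolla b ys)
          ≈⟨ gather-apply 𝕋 𝕋 (L-linearʳ a x) φ b ys tree ⟩
        gather φ b ys (λ b′ cs → L a x (tree b′ cs))
          ≈⟨ gather-cong φ b ys (λ b′ cs → ltrans (eval-single 𝕋 (graftOnto a x) (node b′ cs)) (graftOnto-node b′ cs)) ⟩
        gather φ b ys (λ b′ cs → eval 𝕋 (λ p → new (proj₁ p) (proj₂ p) cs) (φ (a , b′))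
                                  +ᴹ ∂ᵇ 𝕋 (graftOnto a x) (tree b′) cs)
          ≈⟨ gather-+ φ b ys _ _ ⟩
        gather φ b ys (λ b′ cs → eval 𝕋 (λ p → new (proj₁ p) (proj₂ p) cs) (φ (a , b′)))
          +ᴹ gather φ b ys (λ b′ cs → ∂ᵇ 𝕋 (graftOnto a x) (tree b′) cs)
          ≈⟨ lapp (gather-compatible φ φ compatible a b ys new) (gather-∂ φ (graftOnto a x) b ys tree) ⟩
        eval 𝕋 (λ p → gather φ (proj₂ p) ys (new (proj₁ p))) (φ (a , b)) +ᴹ ∂ 𝕋 (L a x) (corolla b) ys
          ≈⟨ lapp (eval-cong 𝕋 (λ p → gather-eval φ (proj₂ p) ys
               (λ t b′ cs → tree b′ ((proj₁ p , t) ∷ cs)) x) (φ (a , b))) lrefl ⟩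
        corolla b ((a , x) ∷ ys) +ᴹ ∂ 𝕋 (L a x) (corolla b) ys ∎
        where
        new : Index → Index → Forest → Lin K T
        new a′ b′ cs = eval 𝕋 (λ t → tree b′ ((a′ , t) ∷ cs)) x
        graftOnto-node : ∀ b′ cs → graftOnto a x (node b′ cs) ≈ᴹ
          eval 𝕋 (λ p → new (proj₁ p) (proj₂ p) cs) (φ (a , b′)) +ᴹ ∂ᵇ 𝕋 (graftOnto a x) (tree b′) cs
        graftOnto-node b′ cs =
          ltrans (eval-cong 𝕋 (λ t → graft-node a t b′ cs) x)
          (ltrans (eval-+ 𝕋 _ _ x)
          (lapp (eval-comm 𝕋 (λ t p → tree (proj₂ p) ((proj₁ p , t) ∷ cs)) x (φ (a , b′)))
                (∂ᵇ-bind 𝕋 (graft K d φ a) (tree b′) x cs)))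

      -- The identity with both negative terms moved across. Only the third argument is fixed,
      -- because the induction is on it alone.
      PreLieAt : Lin K T → Set _
      PreLieAt z = ∀ a a′ x y → (L a x (L a′ y z) +ᴹ L a (L a′ y x) z) ≈ᴹ (L a′ y (L a x z) +ᴹ L a′ (L a x y) z)

      preLie-corolla : ∀ b ys → All (PreLieAt ∘ proj₂) ys → PreLieAt (corolla b ys)
      preLie-corolla b ys hs a a′ x y = begin
        L a x (L a′ y (corolla b ys)) +ᴹ L a (L a′ y x) (corolla b ys)
          -- `PQ`: both grafted at the root. `B`: x inside y, which hangs at the root. `U`, `V`: one
          -- at the root, the other in a branch. `∂∂`: both in branches. `A` and `∂L` come from
          -- grafting y ◁ x as a whole.
          ≈⟨ expand a x a′ y ⟩
        ((PQ +ᴹ (B +ᴹ U)) +ᴹ (V +ᴹ ∂∂)) +ᴹ (A +ᴹ ∂L)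
          ≈⟨ gatherTerms PQ B U V ∂∂ A ∂L ⟩
        (PQ +ᴹ ((B +ᴹ A) +ᴹ (U +ᴹ V))) +ᴹ (∂∂ +ᴹ ∂L)
          ≈⟨ lapp (lapp (corolla-symmetric b (swap (a , x) (a′ , y) ys))
                        (lapp (lswap {xs = B} {ys = A}) (lswap {xs = U} {ys = V})))
                  (∂-commutator 𝕋 𝕋 (L a x) (L a′ y) (L a′ (L a x y)) (L a (L a′ y x))
                    (corolla b) (corolla-linear b) ys (All.map (λ h → h a a′ x y) hs)) ⟩
        (QP +ᴹ ((A +ᴹ B) +ᴹ (V +ᴹ U))) +ᴹ (∂∂′ +ᴹ ∂L′)
          ≈⟨ gatherTerms QP A V U ∂∂′ B ∂L′ ⟨
        ((QP +ᴹ (A +ᴹ V)) +ᴹ (U +ᴹ ∂∂′)) +ᴹ (B +ᴹ ∂L′)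
          ≈⟨ expand a′ y a x ⟨
        L a′ y (L a x (corolla b ys)) +ᴹ L a′ (L a x y) (corolla b ys) ∎
        where
        A B U V PQ QP ∂∂ ∂∂′ ∂L ∂L′ : Lin K T
        PQ  = corolla b ((a , x) ∷ (a′ , y) ∷ ys)
        QP  = corolla b ((a′ , y) ∷ (a , x) ∷ ys)
        ∂∂  = ∂ 𝕋 (L a′ y) (∂ 𝕋 (L a x) (corolla b)) ys
        ∂∂′ = ∂ 𝕋 (L a x) (∂ 𝕋 (L a′ y) (corolla b)) ys
        ∂L  = ∂ 𝕋 (L a (L a′ y x)) (corolla b) ys
        ∂L′ = ∂ 𝕋 (L a′ (L a x y)) (corolla b) ys
        A = corolla b ((a , L a′ y x) ∷ ys)
        B = corolla b ((a′ , L a x y) ∷ ys)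
        U = ∂ 𝕋 (L a x) (λ zs → corolla b ((a′ , y) ∷ zs)) ys
        V = ∂ 𝕋 (L a′ y) (λ zs → corolla b ((a , x) ∷ zs)) ys
        expand : ∀ a x a′ y →
          L a x (L a′ y (corolla b ys)) +ᴹ L a (L a′ y x) (corolla b ys) ≈ᴹ
          ((corolla b ((a , x) ∷ (a′ , y) ∷ ys) +ᴹ
             (corolla b ((a′ , L a x y) ∷ ys) +ᴹ ∂ 𝕋 (L a x) (λ zs → corolla b ((a′ , y) ∷ zs)) ys)) +ᴹ
           (∂ 𝕋 (L a′ y) (λ zs → corolla b ((a , x) ∷ zs)) ys +ᴹ ∂ 𝕋 (L a′ y) (∂ 𝕋 (L a x) (corolla b)) ys)) +ᴹ
          (corolla b ((a , L a′ y x) ∷ ys) +ᴹ ∂ 𝕋 (L a (L a′ y x)) (corolla b) ys)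
        expand a x a′ y = lapp
          (ltrans (Linear.cong (L-linearʳ a x) (L-corolla a′ y b ys))
          (ltrans (Linear.+-homo (L-linearʳ a x) (corolla b ((a′ , y) ∷ ys)) _)
          (lapp (L-corolla a x b ((a′ , y) ∷ ys))
          (ltrans (∂-apply 𝕋 𝕋 (L-linearʳ a x) (L a′ y) (corolla b) ys)
          (ltrans (∂-cong 𝕋 (L a′ y) ys (λ zs _ → L-corolla a x b zs)) (∂-+ 𝕋 (L a′ y) _ _ ys))))))
          (L-corolla a (L a′ y x) b ys)
        open CommutativeMonoidSolver +ᴹ-commutativeMonoid
        gatherTerms : ∀ n e u v s g t → ((n +ᴹ (e +ᴹ u)) +ᴹ (v +ᴹ s)) +ᴹ (g +ᴹ t) ≈ᴹ
                                        (n +ᴹ ((e +ᴹ g) +ᴹ (u +ᴹ v))) +ᴹ (s +ᴹ t)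
        gatherTerms = solve 7 (λ n e u v s g t → (((n ⊕ (e ⊕ u)) ⊕ (v ⊕ s)) ⊕ (g ⊕ t)) ⊜
                                                 ((n ⊕ ((e ⊕ g) ⊕ (u ⊕ v))) ⊕ (s ⊕ t))) lrefl

      PreLieAt-resp : ∀ {z z′} → z ≈ᴹ z′ → PreLieAt z → PreLieAt z′
      PreLieAt-resp z≈ h a a′ x y =
        ltrans (lsym (lapp (Linear.cong (L-linearʳ a x) (Linear.cong (L-linearʳ a′ y) z≈))
                           (Linear.cong (L-linearʳ a (L a′ y x)) z≈)))
        (ltrans (h a a′ x y)
        (lapp (Linear.cong (L-linearʳ a′ y) (Linear.cong (L-linearʳ a x) z≈))
              (Linear.cong (L-linearʳ a′ (L a x y)) z≈)))

      preLie-θ : ∀ t → PreLieAt (θ K d φ t)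
      preLie-θ = Tree-induction _ (λ b cs hs →
        PreLieAt-resp (lsym (θ-node b cs)) (preLie-corolla b _ (All.map⁺ hs)))

      preLie-Θ : ∀ w → PreLieAt (Θ K d φ w)
      preLie-Θ w a a′ x y =
        ltrans (linear-eval 𝕋 𝕋 (linear-side a a′ x y) (θ K d φ) w)
        (ltrans (eval-cong 𝕋 (λ t → preLie-θ t a a′ x y) w)
        (lsym (linear-eval 𝕋 𝕋 (linear-side a′ a y x) (θ K d φ) w)))
        where
        linear-side : ∀ a a′ x y → Linear 𝕋 𝕋 (λ z → L a x (L a′ y z) +ᴹ L a (L a′ y x) z)
        linear-side a a′ x y = linear-+ 𝕋 𝕋
          (linear-∘ 𝕋 𝕋 𝕋 (L-linearʳ a x) (L-linearʳ a′ y)) (L-linearʳ a (L a′ y x))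

      ◁◁≈L : ∀ x as y as′ z → ◁[_] K d φ x as (◁[_] K d φ y as′ z) ≈ᴹ
             eval 𝕋 (λ a → eval 𝕋 (λ a′ → L a x (L a′ y z)) as′) as
      ◁◁≈L x as y as′ z = ltrans (◁≈L x as (◁[_] K d φ y as′ z))
        (eval-cong 𝕋 (λ a → ltrans (Linear.cong (L-linearʳ a x) (◁≈L y as′ z))
          (linear-eval 𝕋 𝕋 (L-linearʳ a x) (λ a′ → L a′ y z) as′)) as)

      ◁◁≈Lˡ : ∀ x as y as′ z → ◁[_] K d φ (◁[_] K d φ x as y) as′ z ≈ᴹ
              eval 𝕋 (λ a → eval 𝕋 (λ a′ → L a′ (L a x y) z) as′) as
      ◁◁≈Lˡ x as y as′ z = ltrans (◁≈L (◁[_] K d φ x as y) as′ z)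
        (ltrans (eval-cong 𝕋 (λ a′ → ltrans (Linear.cong (L-linearˡ a′ z) (◁≈L x as y))
          (linear-eval 𝕋 𝕋 (L-linearˡ a′ z) (λ a → L a x y) as)) as′)
        (eval-comm 𝕋 (λ a′ a → L a′ (L a x y) z) as′ as))

      ◁-preLie : ∀ as as′ x y z → PreLieAt z →
        (◁[_] K d φ x as (◁[_] K d φ y as′ z) +ᴹ ◁[_] K d φ (◁[_] K d φ y as′ x) as z) ≈ᴹ
        (◁[_] K d φ y as′ (◁[_] K d φ x as z) +ᴹ ◁[_] K d φ (◁[_] K d φ x as y) as′ z)
      ◁-preLie as as′ x y z h = begin
        ◁[_] K d φ x as (◁[_] K d φ y as′ z) +ᴹ ◁[_] K d φ (◁[_] K d φ y as′ x) as z
          ≈⟨ lapp (◁◁≈L x as y as′ z) (ltrans (◁◁≈Lˡ y as′ x as z)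
               (eval-comm 𝕋 (λ a′ a → L a (L a′ y x) z) as′ as)) ⟩
        eval 𝕋 (λ a → eval 𝕋 (λ a′ → L a x (L a′ y z)) as′) as +ᴹ
        eval 𝕋 (λ a → eval 𝕋 (λ a′ → L a (L a′ y x) z) as′) as
          ≈⟨ split as as′ _ _ ⟨
        eval 𝕋 (λ a → eval 𝕋 (λ a′ → L a x (L a′ y z) +ᴹ L a (L a′ y x) z) as′) as
          ≈⟨ eval-cong 𝕋 (λ a → eval-cong 𝕋 (λ a′ → h a a′ x y) as′) as ⟩
        eval 𝕋 (λ a → eval 𝕋 (λ a′ → L a′ y (L a x z) +ᴹ L a′ (L a x y) z) as′) as
          ≈⟨ split as as′ _ _ ⟩
        eval 𝕋 (λ a → eval 𝕋 (λ a′ → L a′ y (L a x z)) as′) as +ᴹ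
        eval 𝕋 (λ a → eval 𝕋 (λ a′ → L a′ (L a x y) z) as′) as
          ≈⟨ lapp (ltrans (◁◁≈L y as′ x as z) (eval-comm 𝕋 (λ a′ a → L a′ y (L a x z)) as′ as))
                  (◁◁≈Lˡ x as y as′ z) ⟨
        ◁[_] K d φ y as′ (◁[_] K d φ x as z) +ᴹ ◁[_] K d φ (◁[_] K d φ x as y) as′ z ∎
        where
        split : ∀ as as′ (f g : Index → Index → Lin K T) →
          eval 𝕋 (λ a → eval 𝕋 (λ a′ → f a a′ +ᴹ g a a′) as′) as ≈ᴹ
          eval 𝕋 (λ a → eval 𝕋 (f a) as′) as +ᴹ eval 𝕋 (λ a → eval 𝕋 (g a) as′) as
        split as as′ f g = ltrans (eval-cong 𝕋 (λ a → eval-+ 𝕋 (f a) (g a) as′) as) (eval-+ 𝕋 _ _ as)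

  module ◁₀ = Product (idφ K d)

  graft₀-node : ∀ a t b cs → graft K d (idφ K d) a t (node b cs) ≈ᴹ
                tree b ((a , t) ∷ cs) +ᴹ ∂ᵇ 𝕋 (graft K d (idφ K d) a t) (tree b) cs
  graft₀-node a t b cs = ltrans (◁₀.graft-node a t b cs)
    (lapp (eval-single 𝕋 (λ p → tree (proj₂ p) ((proj₁ p , t) ∷ cs)) (a , b)) lrefl)

  module _ (φ : Endomorphism) (compatible : Compatible φ φ) where
    open Product φ
    open Compatibility compatible

    Θ-tree : ∀ b cs → Θ K d φ (tree b cs) ≈ᴹ corolla b (mapᶠ (θ K d φ) cs)
    Θ-tree b cs = ltrans (eval-single 𝕋 (θ K d φ) (node b cs)) (θ-node b cs)

    Θ-graft : ∀ a t s → Θ K d φ (graft K d (idφ K d) a t s) ≈ᴹ L a (θ K d φ t) (θ K d φ s)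
    Θ-graft a t = Tree-induction _ λ b cs hs → begin
      Θ K d φ (graft K d (idφ K d) a t (node b cs))
        ≈⟨ ltrans (Linear.cong Θ-linear (graft₀-node a t b cs))
             (Linear.+-homo Θ-linear (tree b ((a , t) ∷ cs)) (∂ᵇ 𝕋 (graft K d (idφ K d) a t) (tree b) cs)) ⟩
      Θ K d φ (tree b ((a , t) ∷ cs)) +ᴹ Θ K d φ (∂ᵇ 𝕋 (graft K d (idφ K d) a t) (tree b) cs)
        ≈⟨ lapp (Θ-tree b ((a , t) ∷ cs))
             (ltrans (∂ᵇ-apply 𝕋 𝕋 Θ-linear (graft K d (idφ K d) a t) (tree b) cs)
             (ltrans (∂ᵇ-cong 𝕋 (graft K d (idφ K d) a t) cs (λ ds _ → Θ-tree b ds))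
             (∂ᵇ-natural 𝕋 𝕋 (θ K d φ) (graft K d (idφ K d) a t) (L a (θ K d φ t))
               (corolla b) (corolla-linear b) cs hs))) ⟩
      corolla b ((a , θ K d φ t) ∷ mapᶠ (θ K d φ) cs) +ᴹ ∂ 𝕋 (L a (θ K d φ t)) (corolla b) (mapᶠ (θ K d φ) cs)
        ≈⟨ L-corolla a (θ K d φ t) b (mapᶠ (θ K d φ) cs) ⟨
      L a (θ K d φ t) (corolla b (mapᶠ (θ K d φ) cs))
        ≈⟨ Linear.cong (L-linearʳ a (θ K d φ t)) (θ-node b cs) ⟨
      L a (θ K d φ t) (θ K d φ (node b cs)) ∎

    Θ-morphism : ∀ as x y → Θ K d φ (◁₀ K d x as y) ≈ᴹ ◁[_] K d φ (Θ K d φ x) as (Θ K d φ y)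
    Θ-morphism as x y = begin
      Θ K d φ (◁₀ K d x as y)
        ≈⟨ linear-eval 𝕋 𝕋 Θ-linear (λ a → bind K (λ t → bind K (graft K d (idφ K d) a t) y) x) as ⟩
      eval 𝕋 (λ a → Θ K d φ (bind K (λ t → bind K (graft K d (idφ K d) a t) y) x)) as
        ≈⟨ eval-cong 𝕋 (λ a →
             ltrans (linear-eval 𝕋 𝕋 Θ-linear (λ t → bind K (graft K d (idφ K d) a t) y) x)
             (ltrans (eval-cong 𝕋 (λ t → ltrans (linear-eval 𝕋 𝕋 Θ-linear (graft K d (idφ K d) a t) y)
               (ltrans (eval-cong 𝕋 (Θ-graft a t) y)
               (lsym (linear-eval 𝕋 𝕋 (L-linearʳ a (θ K d φ t)) (θ K d φ) y)))) x)
             (lsym (linear-eval 𝕋 𝕋 (L-linearˡ a (Θ K d φ y)) (θ K d φ) x)))) as ⟩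
      eval 𝕋 (λ a → L a (Θ K d φ x) (Θ K d φ y)) as
        ≈⟨ ◁≈L (Θ K d φ x) as (Θ K d φ y) ⟨
      ◁[_] K d φ (Θ K d φ x) as (Θ K d φ y) ∎

  module _ (φ ψ : Endomorphism) (φφ : Compatible φ φ) (ψψ : Compatible ψ ψ) (φψ : Compatible φ ψ)
           (inverse : Inverse φ ψ) where
    private
      module φ = Product.Compatibility φ φφ
      module ψ = Product.Compatibility ψ ψψ

    Θ-θ : ∀ t → Θ K d ψ (θ K d φ t) ≈ᴹ single K t
    Θ-θ = Tree-induction _ λ b cs hs → begin
      Θ K d ψ (θ K d φ (node b cs))
        ≈⟨ Linear.cong ψ.Θ-linear (Product.θ-node φ b cs) ⟩
      Θ K d ψ (Product.corolla φ b (mapᶠ (θ K d φ) cs))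
        ≈⟨ gather-apply 𝕋 𝕋 ψ.Θ-linear φ b (mapᶠ (θ K d φ) cs) tree ⟩
      gather φ b (mapᶠ (θ K d φ) cs) (λ b′ ds → Θ K d ψ (tree b′ ds))
        ≈⟨ gather-cong φ b (mapᶠ (θ K d φ) cs) (Θ-tree ψ ψψ) ⟩
      gather φ b (mapᶠ (θ K d φ) cs) (λ b′ ds → gather ψ b′ (mapᶠ (θ K d ψ) ds) tree)
        ≈⟨ gather-inverse φ ψ φψ inverse (θ K d ψ) b (mapᶠ (θ K d φ) cs) tree ⟩
      gather (idφ K d) b (List.map (map₂ (Θ K d ψ)) (mapᶠ (θ K d φ) cs)) tree
        ≡⟨ ≡.cong (λ ys → gather (idφ K d) b ys tree) (≡.sym (List.map-∘ cs)) ⟩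
      gather (idφ K d) b (mapᶠ (Θ K d ψ ∘ θ K d φ) cs) tree
        ≈⟨ gather-symmetric (idφ K d) idφ-compatible tree tree-cong b
             (∼-pointwise 𝕋 (Θ K d ψ ∘ θ K d φ) (single K) cs hs) ⟩
      gather (idφ K d) b (mapᶠ (single K) cs) tree
        ≈⟨ gather-single b cs tree ⟩
      single K (node b cs) ∎

    Θ-inverse : ∀ x → Θ K d ψ (Θ K d φ x) ≈ᴹ x
    Θ-inverse x = ltrans (linear-eval 𝕋 𝕋 ψ.Θ-linear (θ K d φ) x)
      (ltrans (eval-cong 𝕋 Θ-θ x) (lsym (single-expansion _≃_ x)))

-- Identities between differences, with and without signs

module Differences {c ℓ : Level} (K : Field c ℓ) {m ℓm : Level} (M : LinearAlgebra.Mod K m ℓm) where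
  open Module M
  open SetoidReasoning ≈ᴹ-setoid
  open CommutativeMonoidSolver +ᴹ-commutativeMonoid

  +-exchange⇒difference : ∀ p q r s → p +ᴹ s ≈ᴹ r +ᴹ q → p +ᴹ -ᴹ q ≈ᴹ r +ᴹ -ᴹ s
  +-exchange⇒difference p q r s h = begin
    p +ᴹ -ᴹ q                       ≈⟨ +ᴹ-identityʳ _ ⟨
    (p +ᴹ -ᴹ q) +ᴹ 0ᴹ               ≈⟨ +ᴹ-congˡ (-ᴹ‿inverseʳ s) ⟨
    (p +ᴹ -ᴹ q) +ᴹ (s +ᴹ -ᴹ s)
      ≈⟨ solve 4 (λ p q s t → ((p ⊕ q) ⊕ (s ⊕ t)) ⊜ ((p ⊕ s) ⊕ (t ⊕ q)))
           ≈ᴹ-refl p (-ᴹ q) s (-ᴹ s) ⟩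
    (p +ᴹ s) +ᴹ (-ᴹ s +ᴹ -ᴹ q)      ≈⟨ +ᴹ-congʳ h ⟩
    (r +ᴹ q) +ᴹ (-ᴹ s +ᴹ -ᴹ q)      ≈⟨ LinearAlgebra.+-interchange K M r q (-ᴹ s) (-ᴹ q) ⟩
    (r +ᴹ -ᴹ s) +ᴹ (q +ᴹ -ᴹ q)      ≈⟨ +ᴹ-congˡ (-ᴹ‿inverseʳ q) ⟩
    (r +ᴹ -ᴹ s) +ᴹ 0ᴹ               ≈⟨ +ᴹ-identityʳ _ ⟩
    r +ᴹ -ᴹ s                       ∎

  difference⇒+-exchange : ∀ p q r s → p +ᴹ -ᴹ q ≈ᴹ r +ᴹ -ᴹ s → p +ᴹ s ≈ᴹ r +ᴹ q
  difference⇒+-exchange p q r s h = begin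
    p +ᴹ s                          ≈⟨ +ᴹ-identityʳ _ ⟨
    (p +ᴹ s) +ᴹ 0ᴹ                  ≈⟨ +ᴹ-congˡ (-ᴹ‿inverseˡ q) ⟨
    (p +ᴹ s) +ᴹ (-ᴹ q +ᴹ q)
      ≈⟨ solve 4 (λ p q s t → ((p ⊕ s) ⊕ (t ⊕ q)) ⊜ ((p ⊕ t) ⊕ (s ⊕ q)))
           ≈ᴹ-refl p q s (-ᴹ q) ⟩
    (p +ᴹ -ᴹ q) +ᴹ (s +ᴹ q)         ≈⟨ +ᴹ-congʳ h ⟩
    (r +ᴹ -ᴹ s) +ᴹ (s +ᴹ q)
      ≈⟨ solve 4 (λ r q s t → ((r ⊕ t) ⊕ (s ⊕ q)) ⊜ ((r ⊕ q) ⊕ (t ⊕ s)))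
           ≈ᴹ-refl r q s (-ᴹ s) ⟩
    (r +ᴹ q) +ᴹ (-ᴹ s +ᴹ s)         ≈⟨ +ᴹ-congˡ (-ᴹ‿inverseˡ s) ⟩
    (r +ᴹ q) +ᴹ 0ᴹ                  ≈⟨ +ᴹ-identityʳ _ ⟩
    r +ᴹ q                          ∎

-- Freeness

module Freeness {c ℓ : Level} (K : Field c ℓ) (d : ℕ) {m ℓm : Level} (A : MultiplePreLie K d m ℓm) where
  open LinearAlgebra K
  open Trees K d
  open Derivations K Index
  open Grafting K d
  open MultiplePreLie A hiding (pre-Lie)
  open SetoidReasoning ≈ᴹ-setoid

  𝔸 : Mod m ℓm
  𝔸 = module'

  act : Index → Carrierᴹ → Carrierᴹ → Carrierᴹ
  act a y z = y ◁⟨ single K a ⟩ z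

  act-linearʳ : ∀ a y → Linear 𝔸 𝔸 (act a y)
  act-linearʳ a y = record { cong = E.cong ; +-homo = E.additive ; *-homo = E.homogeneous }
    where module E = IsEndo (linear-r (single K a) y)

  act-linearˡ : ∀ a z → Linear 𝔸 𝔸 (λ y → act a y z)
  act-linearˡ a z = record { cong = E.cong ; +-homo = E.additive ; *-homo = E.homogeneous }
    where module E = IsEndo (linear-l (single K a) z)

  act-cong : ∀ a {y y′ z z′} → y ≈ᴹ y′ → z ≈ᴹ z′ → act a y z ≈ᴹ act a y′ z′
  act-cong a y≈ z≈ = ≈ᴹ-trans (Linear.cong (act-linearˡ a _) y≈) (Linear.cong (act-linearʳ a _) z≈)

  act-preLie : ∀ a a′ x y z → act a x (act a′ y z) +ᴹ act a (act a′ y x) z ≈ᴹ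
                              act a′ y (act a x z) +ᴹ act a′ (act a x y) z
  act-preLie a a′ x y z = Differences.difference⇒+-exchange K 𝔸 _ _ _ _
    (MultiplePreLie.pre-Lie A (single K a) (single K a′) x y z)

  -- The operation extending x by the branches (a₁, y₁) … (aₙ, yₙ), as in Guin–Oudom: grafting the
  -- first branch onto the whole and subtracting the terms where it lands on another branch.
  -- The numeral bounds the number of branches.
  brace : Carrierᴹ → ℕ → List (Index × Carrierᴹ) → Carrierᴹ
  brace x n       []             = x
  -- Never reached from `braces`; the value 0 keeps multilinearity and symmetry valid for every
  -- bound.
  brace x zero    (_ ∷ _)        = 0ᴹ
  brace x (suc n) ((a , y) ∷ ys) = act a y (brace x n ys) +ᴹ -ᴹ ∂ 𝔸 (act a y) (brace x n) ys

  module _ (x : Carrierᴹ) where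

    brace-linear : ∀ n → Multilinear 𝔸 𝔸 (brace x n)
    brace-linear zero    []                e ys = linear-0 𝔸 𝔸
    brace-linear zero    (_ ∷ _)           e ys = linear-0 𝔸 𝔸
    brace-linear (suc n) []                e ys = linear-+ 𝔸 𝔸 (act-linearˡ e (brace x n ys))
      (linear-∘ 𝔸 𝔸 𝔸 (linear-neg 𝔸) (∂-linear-D 𝔸 𝔸 𝔸 (act e) (act-linearˡ e) (brace x n) (brace-linear n) ys))
    brace-linear (suc n) ((e′ , y) ∷ xs) e ys = linear-+ 𝔸 𝔸
      (linear-∘ 𝔸 𝔸 𝔸 (act-linearʳ e′ y) (brace-linear n xs e ys))
      (linear-∘ 𝔸 𝔸 𝔸 (linear-neg 𝔸) (∂-multilinear 𝔸 𝔸 (act-linearʳ e′ y) (brace x n) (brace-linear n) xs e ys))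

    brace-suc : ∀ n a y ys → brace x (suc n) ((a , y) ∷ ys) +ᴹ ∂ 𝔸 (act a y) (brace x n) ys ≈ᴹ
                             act a y (brace x n ys)
    brace-suc n a y ys =
      ≈ᴹ-trans (+ᴹ-assoc _ _ _) (≈ᴹ-trans (+ᴹ-congˡ (-ᴹ‿inverseˡ _)) (+ᴹ-identityʳ _))

    -- Settles transpositions under the bound 1, where `brace-swap` cannot unfold twice.
    brace-one : ∀ p q ys → brace x 1 (p ∷ q ∷ ys) ≈ᴹ 0ᴹ
    brace-one (a , y) q ys = begin
      brace x 1 ((a , y) ∷ q ∷ ys)
        ≈⟨ +ᴹ-identityʳ _ ⟨
      brace x 1 ((a , y) ∷ q ∷ ys) +ᴹ 0ᴹ
        ≈⟨ +ᴹ-congˡ (≈ᴹ-trans (+ᴹ-identityˡ _) (∂-0 𝔸 (act a y) ys)) ⟨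
      brace x 1 ((a , y) ∷ q ∷ ys) +ᴹ ∂ 𝔸 (act a y) (brace x 0) (q ∷ ys)
        ≈⟨ brace-suc 0 a y (q ∷ ys) ⟩
      act a y 0ᴹ
        ≈⟨ Linear.0-homo (act-linearʳ a y) ⟩
      0ᴹ ∎

    -- Both sides are unfolded twice with the subtracted terms moved across. Exchanging the branches
    -- exchanges `R` with `S` and `V` with `W`, so once `V` is added as well, the auxiliary summand
    -- is the same on both sides and can be cancelled.
    brace-swap : ∀ n a y a′ z ys → brace x (suc (suc n)) ((a , y) ∷ (a′ , z) ∷ ys) ≈ᴹ
                                   brace x (suc (suc n)) ((a′ , z) ∷ (a , y) ∷ ys)
    brace-swap n a y a′ z ys = +ᴹ-cancelʳ ((W +ᴹ (S +ᴹ R)) +ᴹ V) _ _ (begin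
      B₂ a y a′ z +ᴹ ((W +ᴹ (S +ᴹ R)) +ᴹ V)
        ≈⟨ +ᴹ-congˡ (solve 4 (λ w s r v → ((w ⊕ (s ⊕ r)) ⊕ v) ⊜ (((w ⊕ r) ⊕ s) ⊕ v)) ≈ᴹ-refl W S R V) ⟩
      B₂ a y a′ z +ᴹ (((W +ᴹ R) +ᴹ S) +ᴹ V)
        ≈⟨ +ᴹ-assoc _ _ _ ⟨
      (B₂ a y a′ z +ᴹ ((W +ᴹ R) +ᴹ S)) +ᴹ V
        ≈⟨ +ᴹ-congʳ (expand a y a′ z) ⟩
      ((act a y (act a′ z b) +ᴹ D a′ (act a y z)) +ᴹ ∂ 𝔸 (act a y) (∂ 𝔸 (act a′ z) (brace x n)) ys) +ᴹ V
        ≈⟨ solve 4 (λ p q r s → (((p ⊕ q) ⊕ r) ⊕ s) ⊜ ((p ⊕ s) ⊕ (r ⊕ q))) ≈ᴹ-refl _ _ _ _ ⟩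
      (act a y (act a′ z b) +ᴹ V) +ᴹ (∂ 𝔸 (act a y) (∂ 𝔸 (act a′ z) (brace x n)) ys +ᴹ D a′ (act a y z))
        -- The pre-Lie identity of A enters twice: at `b`, the brace of the remaining branches, and
        -- at each of these branches.
        ≈⟨ +ᴹ-cong (act-preLie a a′ y z b) (∂-commutator 𝔸 𝔸 (act a′ z) (act a y) (act a (act a′ z y))
             (act a′ (act a y z)) (brace x n) (brace-linear n) ys
             (All.universal (λ p → act-preLie a′ a z y (proj₂ p)) ys)) ⟩
      (act a′ z (act a y b) +ᴹ W) +ᴹ (∂ 𝔸 (act a′ z) (∂ 𝔸 (act a y) (brace x n)) ys +ᴹ D a (act a′ z y))
        ≈⟨ solve 4 (λ p q r s → (((p ⊕ q) ⊕ r) ⊕ s) ⊜ ((p ⊕ s) ⊕ (r ⊕ q))) ≈ᴹ-refl _ _ _ _ ⟨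
      ((act a′ z (act a y b) +ᴹ D a (act a′ z y)) +ᴹ ∂ 𝔸 (act a′ z) (∂ 𝔸 (act a y) (brace x n)) ys) +ᴹ W
        ≈⟨ +ᴹ-congʳ (expand a′ z a y) ⟨
      (B₂ a′ z a y +ᴹ ((V +ᴹ S) +ᴹ R)) +ᴹ W
        ≈⟨ ≈ᴹ-trans (+ᴹ-assoc _ _ _) (+ᴹ-congˡ
             (solve 4 (λ w s r v → (((v ⊕ s) ⊕ r) ⊕ w) ⊜ ((w ⊕ (s ⊕ r)) ⊕ v)) ≈ᴹ-refl W S R V)) ⟩
      B₂ a′ z a y +ᴹ ((W +ᴹ (S +ᴹ R)) +ᴹ V) ∎)
      where
      open AbelianGroupProperties +ᴹ-abelianGroup using () renaming (∙-cancelʳ to +ᴹ-cancelʳ)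
      open CommutativeMonoidSolver +ᴹ-commutativeMonoid
      b R S V W : Carrierᴹ
      b = brace x n ys
      R = act a′ z (∂ 𝔸 (act a y) (brace x n) ys)
      S = act a y (∂ 𝔸 (act a′ z) (brace x n) ys)
      V = act a (act a′ z y) b
      W = act a′ (act a y z) b
      B₂ : Index → Carrierᴹ → Index → Carrierᴹ → Carrierᴹ
      B₂ a y a′ z = brace x (suc (suc n)) ((a , y) ∷ (a′ , z) ∷ ys)
      D : Index → Carrierᴹ → Carrierᴹ
      D a y = ∂ 𝔸 (act a y) (brace x n) ys
      expand : ∀ a y a′ z →
        B₂ a y a′ z +ᴹ ((act a′ (act a y z) b +ᴹ act a′ z (D a y)) +ᴹ act a y (D a′ z)) ≈ᴹ
        (act a y (act a′ z b) +ᴹ D a′ (act a y z)) +ᴹ ∂ 𝔸 (act a y) (∂ 𝔸 (act a′ z) (brace x n)) ys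
      expand a y a′ z = begin
        B₂ a y a′ z +ᴹ ((act a′ (act a y z) b +ᴹ act a′ z (D a y)) +ᴹ act a y (D a′ z))
          ≈⟨ +ᴹ-congˡ (+ᴹ-congʳ (+ᴹ-cong (brace-suc n a′ (act a y z) ys) tail)) ⟨
        B₂ a y a′ z +ᴹ (((H +ᴹ D a′ (act a y z)) +ᴹ (J +ᴹ ∂∂)) +ᴹ act a y (D a′ z))
          ≈⟨ solve 6 (λ c h e j f g → (c ⊕ (((h ⊕ e) ⊕ (j ⊕ f)) ⊕ g)) ⊜ (((c ⊕ (h ⊕ j)) ⊕ g) ⊕ (e ⊕ f)))
               ≈ᴹ-refl (B₂ a y a′ z) H (D a′ (act a y z)) J ∂∂ (act a y (D a′ z)) ⟩
        ((B₂ a y a′ z +ᴹ (H +ᴹ J)) +ᴹ act a y (D a′ z)) +ᴹ (D a′ (act a y z) +ᴹ ∂∂)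
          ≈⟨ +ᴹ-congʳ (+ᴹ-congʳ (brace-suc (suc n) a y ((a′ , z) ∷ ys))) ⟩
        (act a y (brace x (suc n) ((a′ , z) ∷ ys)) +ᴹ act a y (D a′ z)) +ᴹ (D a′ (act a y z) +ᴹ ∂∂)
          ≈⟨ +ᴹ-congʳ (≈ᴹ-trans (≈ᴹ-sym (Linear.+-homo (act-linearʳ a y) _ _))
               (Linear.cong (act-linearʳ a y) (brace-suc n a′ z ys))) ⟩
        act a y (act a′ z b) +ᴹ (D a′ (act a y z) +ᴹ ∂∂)
          ≈⟨ +ᴹ-assoc _ _ _ ⟨
        (act a y (act a′ z b) +ᴹ D a′ (act a y z)) +ᴹ ∂∂ ∎
        where
        H J ∂∂ : Carrierᴹ
        H  = brace x (suc n) ((a′ , act a y z) ∷ ys)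
        J  = ∂ 𝔸 (act a y) (λ zs → brace x (suc n) ((a′ , z) ∷ zs)) ys
        ∂∂ = ∂ 𝔸 (act a y) (∂ 𝔸 (act a′ z) (brace x n)) ys
        tail : J +ᴹ ∂∂ ≈ᴹ act a′ z (D a y)
        tail = ≈ᴹ-trans (≈ᴹ-sym (∂-+ 𝔸 (act a y) _ _ ys))
          (≈ᴹ-trans (∂-cong 𝔸 (act a y) ys (λ zs _ → brace-suc n a′ z zs))
          (≈ᴹ-sym (∂-apply 𝔸 𝔸 (act-linearʳ a′ z) (act a y) (brace x n) ys)))

    brace-symmetric : ∀ n → Symmetric 𝔸 𝔸 (brace x n)
    brace-symmetric n       nil           = ≈ᴹ-refl
    brace-symmetric n       (comp e e′)   = ≈ᴹ-trans (brace-symmetric n e) (brace-symmetric n e′)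
    brace-symmetric zero    (skip _ _)    = ≈ᴹ-refl
    brace-symmetric (suc n) (skip y≈ e)   = +ᴹ-cong (act-cong _ y≈ (brace-symmetric n e))
      (-ᴹ‿cong (∂-symmetric 𝔸 𝔸 (act-cong _ y≈) (brace-symmetric n) e))
    brace-symmetric zero    (swap p q ys) = ≈ᴹ-refl
    brace-symmetric (suc zero) (swap p q ys) = ≈ᴹ-trans (brace-one p q ys) (≈ᴹ-sym (brace-one q p ys))
    brace-symmetric (suc (suc n)) (swap (a , y) (a′ , z) ys) = brace-swap n a y a′ z ys

    braces : List (Index × Carrierᴹ) → Carrierᴹ
    braces ys = brace x (length ys) ys

    braces-symmetric : Symmetric 𝔸 𝔸 braces
    braces-symmetric {ys} {zs} e rewrite ∼-length 𝔸 e = brace-symmetric (length zs) e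

    braces-linear : Multilinear 𝔸 𝔸 braces
    braces-linear xs e ys = linear-ext 𝔸 𝔸
      (λ y → ≈ᴹ-reflexive (≡.cong (λ n → brace x n (xs ++ (e , y) ∷ ys)) (List.length-++ xs)))
      (brace-linear (length xs ℕ.+ suc (length ys)) xs e ys)

    -- The counterpart in A of `L-corolla`; both existence and uniqueness of the extension rest on
    -- it.
    braces-∷ : ∀ a y ys → braces ((a , y) ∷ ys) +ᴹ ∂ 𝔸 (act a y) braces ys ≈ᴹ act a y (braces ys)
    braces-∷ a y ys = ≈ᴹ-trans
      (+ᴹ-congˡ (∂-cong 𝔸 (act a y) ys
        (λ zs eq → ≈ᴹ-reflexive (≡.cong (λ n → brace x n zs) eq))))
      (brace-suc (length ys) a y ys)

  module Extension (f : Index → Carrierᴹ) where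

    mutual
      extend : T → Carrierᴹ
      extend (node b cs) = braces (f b) (extendᶠ cs)

      -- `mapᶠ extend` written out, so that the recursion is visibly structural.
      extendᶠ : Forest → List (Index × Carrierᴹ)
      extendᶠ []             = []
      extendᶠ ((a , t) ∷ cs) = (a , extend t) ∷ extendᶠ cs

    extend-node : ∀ b cs → extend (node b cs) ≈ᴹ braces (f b) (mapᶠ extend cs)
    extend-node b cs = ≈ᴹ-reflexive (≡.cong (braces (f b)) (extendᶠ≡ cs))
      where
      extendᶠ≡ : ∀ cs → extendᶠ cs ≡ mapᶠ extend cs
      extendᶠ≡ []       = ≡.refl
      extendᶠ≡ (c ∷ cs) = ≡.cong (_ ∷_) (extendᶠ≡ cs)

    extend-linear : Linear 𝕋 𝔸 (eval 𝔸 extend)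
    extend-linear = eval-linear 𝔸 extend _≃_
      (Recursive.g-cong 𝔸 extend (braces ∘ f) extend-node (braces-symmetric ∘ f))

    extend-graft : ∀ a t s → eval 𝔸 extend (graft K d (idφ K d) a t s) ≈ᴹ act a (extend t) (extend s)
    extend-graft a t = Tree-induction _ λ b cs hs → begin
      eval 𝔸 extend (graft K d (idφ K d) a t (node b cs))
        ≈⟨ ≈ᴹ-trans (Linear.cong extend-linear (graft₀-node a t b cs))
             (Linear.+-homo extend-linear (tree b ((a , t) ∷ cs)) (∂ᵇ 𝕋 (graft K d (idφ K d) a t) (tree b) cs)) ⟩
      eval 𝔸 extend (tree b ((a , t) ∷ cs)) +ᴹ eval 𝔸 extend (∂ᵇ 𝕋 (graft K d (idφ K d) a t) (tree b) cs)
        ≈⟨ +ᴹ-cong (extend-tree b ((a , t) ∷ cs))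
             (≈ᴹ-trans (∂ᵇ-apply 𝕋 𝔸 extend-linear (graft K d (idφ K d) a t) (tree b) cs)
             (≈ᴹ-trans (∂ᵇ-cong 𝔸 (graft K d (idφ K d) a t) cs (λ ds _ → extend-tree b ds))
             (∂ᵇ-natural 𝔸 𝔸 extend (graft K d (idφ K d) a t) (act a (extend t))
               (braces (f b)) (braces-linear (f b)) cs hs))) ⟩
      braces (f b) (mapᶠ extend ((a , t) ∷ cs)) +ᴹ ∂ 𝔸 (act a (extend t)) (braces (f b)) (mapᶠ extend cs)
        ≈⟨ braces-∷ (f b) a (extend t) (mapᶠ extend cs) ⟩
      act a (extend t) (braces (f b) (mapᶠ extend cs))
        ≈⟨ Linear.cong (act-linearʳ a (extend t)) (extend-node b cs) ⟨
      act a (extend t) (extend (node b cs)) ∎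
      where
      extend-tree : ∀ b cs → eval 𝔸 extend (tree b cs) ≈ᴹ braces (f b) (mapᶠ extend cs)
      extend-tree b cs = ≈ᴹ-trans (eval-single 𝔸 extend (node b cs)) (extend-node b cs)

    extend-◁₀ : ∀ x as y → eval 𝔸 extend (◁₀ K d x as y) ≈ᴹ eval 𝔸 extend x ◁⟨ as ⟩ eval 𝔸 extend y
    extend-◁₀ x as y = begin
      eval 𝔸 extend (◁₀ K d x as y)
        ≈⟨ linear-eval 𝕋 𝔸 extend-linear (λ a → bind K (λ t → bind K (graft K d (idφ K d) a t) y) x) as ⟩
      eval 𝔸 (λ a → eval 𝔸 extend (bind K (λ t → bind K (graft K d (idφ K d) a t) y) x)) as
        ≈⟨ eval-cong 𝔸 (λ a →
             ≈ᴹ-trans (linear-eval 𝕋 𝔸 extend-linear (λ t → bind K (graft K d (idφ K d) a t) y) x)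
             (≈ᴹ-trans (eval-cong 𝔸 (λ t → ≈ᴹ-trans (linear-eval 𝕋 𝔸 extend-linear (graft K d (idφ K d) a t) y)
               (≈ᴹ-trans (eval-cong 𝔸 (extend-graft a t) y)
               (≈ᴹ-sym (linear-eval 𝔸 𝔸 (act-linearʳ a (extend t)) extend y)))) x)
             (≈ᴹ-sym (linear-eval 𝔸 𝔸 (act-linearˡ a (eval 𝔸 extend y)) extend x)))) as ⟩
      eval 𝔸 (λ a → act a (eval 𝔸 extend x) (eval 𝔸 extend y)) as
        ≈⟨ linear-free _≡_ 𝔸 (record { cong = E.cong ; +-homo = E.additive ; *-homo = E.homogeneous }) as ⟨
      eval 𝔸 extend x ◁⟨ as ⟩ eval 𝔸 extend y ∎
      where module E = IsLinear (linear-a (eval 𝔸 extend x) (eval 𝔸 extend y))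

    module Uniqueness (G : Lin K T → Carrierᴹ) (G-linear : Linear 𝕋 𝔸 G)
      (G-graft : ∀ a t s → G (graft K d (idφ K d) a t s) ≈ᴹ act a (G (single K t)) (G (single K s)))
      (G-dot : ∀ b → G (tree b []) ≈ᴹ f b) where

      g : T → Carrierᴹ
      g = G ∘ single K

      -- Grafting the first branch onto the rest gives the wanted tree plus trees with one root
      -- branch fewer but larger branches, so the induction is on the number of root branches and
      -- not on the tree.
      G-node : ∀ n b cs → length cs ≡ n → G (tree b cs) ≈ᴹ braces (f b) (mapᶠ g cs)
      G-node n       b []             eq = G-dot b
      G-node (suc n) b ((a , t) ∷ cs) eq = +ᴹ-cancelʳ (∂ 𝔸 (act a (g t)) (braces (f b)) (mapᶠ g cs)) _ _ (begin
        G (tree b ((a , t) ∷ cs)) +ᴹ ∂ 𝔸 (act a (g t)) (braces (f b)) (mapᶠ g cs)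
          ≈⟨ +ᴹ-congˡ (≈ᴹ-trans (∂ᵇ-apply 𝕋 𝔸 G-linear D (tree b) cs)
               (≈ᴹ-trans (∂ᵇ-cong 𝔸 D cs (λ ds eq′ → G-node n b ds (≡.trans eq′ length≡)))
               (∂ᵇ-natural 𝔸 𝔸 g D (act a (g t)) (braces (f b)) (braces-linear (f b)) cs
                 (All.universal (λ p → ≈ᴹ-trans (≈ᴹ-sym (linear-free _≃_ 𝔸 G-linear (D (proj₂ p))))
                                                (G-graft a t (proj₂ p))) cs)))) ⟨
        G (tree b ((a , t) ∷ cs)) +ᴹ G (∂ᵇ 𝕋 D (tree b) cs)
          ≈⟨ Linear.+-homo G-linear (tree b ((a , t) ∷ cs)) (∂ᵇ 𝕋 D (tree b) cs) ⟨
        G (tree b ((a , t) ∷ cs) ++ ∂ᵇ 𝕋 D (tree b) cs)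
          ≈⟨ Linear.cong G-linear (graft₀-node a t b cs) ⟨
        G (graft K d (idφ K d) a t (node b cs))
          ≈⟨ G-graft a t (node b cs) ⟩
        act a (g t) (G (tree b cs))
          ≈⟨ Linear.cong (act-linearʳ a (g t)) (G-node n b cs length≡) ⟩
        act a (g t) (braces (f b) (mapᶠ g cs))
          ≈⟨ braces-∷ (f b) a (g t) (mapᶠ g cs) ⟨
        braces (f b) (mapᶠ g ((a , t) ∷ cs)) +ᴹ ∂ 𝔸 (act a (g t)) (braces (f b)) (mapᶠ g cs) ∎)
        where
        open AbelianGroupProperties +ᴹ-abelianGroup using () renaming (∙-cancelʳ to +ᴹ-cancelʳ)
        D : T → Lin K T
        D = graft K d (idφ K d) a t
        length≡ : length cs ≡ n
        length≡ = ≡.cong ℕ.pred eq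

      g≈extend : ∀ t → g t ≈ᴹ extend t
      g≈extend = Tree-induction _ λ b cs hs →
        ≈ᴹ-trans (G-node (length cs) b cs ≡.refl)
        (≈ᴹ-trans (braces-symmetric (f b) (∼-pointwise 𝔸 g extend cs hs)) (≈ᴹ-sym (extend-node b cs)))

      G≈extend : ∀ x → G x ≈ᴹ eval 𝔸 extend x
      G≈extend x = ≈ᴹ-trans (linear-free _≃_ 𝔸 G-linear x) (eval-cong 𝔸 g≈extend x)

-- Transport of structure along mutually inverse Θ_φ and Θ_ψ

module Transport {c ℓ : Level} (K : Field c ℓ) (d : ℕ) where
  open LinearAlgebra K
  open Trees K d
  open Grafting K d
  open Gather 𝕋

  module MutuallyInverse (φ ψ : Endo K d) (φφ : Compatible φ φ) (ψψ : Compatible ψ ψ)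
           (φψ : Compatible φ ψ) (ψφ : Compatible ψ φ) (φψ-inverse : Inverse φ ψ) (ψφ-inverse : Inverse ψ φ) where
    private
      module φ = Product.Compatibility φ φφ
      module ψ = Product.Compatibility ψ ψψ
      open Module 𝕋
      open SetoidReasoning ≈ᴹ-setoid

    ΘψΘφ : ∀ x → Θ K d ψ (Θ K d φ x) ≈ᴹ x
    ΘψΘφ = Θ-inverse φ ψ φφ ψψ φψ φψ-inverse

    ΘφΘψ : ∀ x → Θ K d φ (Θ K d ψ x) ≈ᴹ x
    ΘφΘψ = Θ-inverse ψ φ ψψ φφ ψφ ψφ-inverse

    isMultiplePreLie : IsMultiplePreLie𝒯 K d φ
    isMultiplePreLie = record
      { cong    = λ as≈ x≈ y≈ → Product.◁-cong φ as≈ x≈ y≈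
      ; pre-Lie = λ as as′ x y z → Differences.+-exchange⇒difference K 𝕋
          (◁[_] K d φ x as (◁[_] K d φ y as′ z)) (◁[_] K d φ (◁[_] K d φ x as y) as′ z)
          (◁[_] K d φ y as′ (◁[_] K d φ x as z)) (◁[_] K d φ (◁[_] K d φ y as′ x) as z)
          (φ.◁-preLie as as′ x y z (φ.PreLieAt-resp (ΘφΘψ z) (φ.preLie-Θ (Θ K d ψ z))))
      }

    isIsoWithInverse : IsIsoWithInverse K d φ ψ
    isIsoWithInverse = record
      { cong        = Linear.cong φ.Θ-linear
      ; cong⁻¹      = Linear.cong ψ.Θ-linear
      ; additive    = Linear.+-homo φ.Θ-linear
      ; homogeneous = Linear.*-homo φ.Θ-linear
      ; morphism    = λ as x y → Θ-morphism φ φφ as x y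
      ; left-inv    = ΘψΘφ
      ; right-inv   = ΘφΘψ
      }

    Θψ-morphism : ∀ as x y → Θ K d ψ (◁[_] K d φ x as y) ≈ᴹ ◁₀ K d (Θ K d ψ x) as (Θ K d ψ y)
    Θψ-morphism as x y = begin
      Θ K d ψ (◁[_] K d φ x as y)
        ≈⟨ Linear.cong ψ.Θ-linear (Product.◁-cong φ {as} {as} lrefl (ΘφΘψ x) (ΘφΘψ y)) ⟨
      Θ K d ψ (◁[_] K d φ (Θ K d φ (Θ K d ψ x)) as (Θ K d φ (Θ K d ψ y)))
        ≈⟨ Linear.cong ψ.Θ-linear (Θ-morphism φ φφ as (Θ K d ψ x) (Θ K d ψ y)) ⟨
      Θ K d ψ (Θ K d φ (◁₀ K d (Θ K d ψ x) as (Θ K d ψ y)))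
        ≈⟨ ΘψΘφ _ ⟩
      ◁₀ K d (Θ K d ψ x) as (Θ K d ψ y) ∎

    freelyGenerated : ∀ {m ℓm} → FreelyGenerated K d m ℓm φ
    freelyGenerated A f f-linear = F ,
      record
        { linear = record
          { cong        = Linear.cong F-linear
          ; additive    = Linear.+-homo F-linear
          ; homogeneous = Linear.*-homo F-linear
          }
        ; preserves = λ as x y → A.≈ᴹ-trans (Linear.cong extend-linear (Θψ-morphism as x y))
                                             (extend-◁₀ (Θ K d ψ x) as (Θ K d ψ y))
        } ,
      F-dot , unique
      where
      module A = MultiplePreLie A
      open Freeness K d A
      open Extension (f ∘ single K)
      F : Lin K T → A.Carrierᴹ
      F = eval 𝔸 extend ∘ Θ K d ψ
      F-linear : Linear 𝕋 𝔸 F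
      F-linear = linear-∘ 𝕋 𝕋 𝔸 extend-linear ψ.Θ-linear
      module f = IsLinear f-linear
      F-dot : ∀ b → F (dot K d b) A.≈ᴹ f b
      F-dot b = A.≈ᴹ-trans (linear-eval 𝕋 𝔸 F-linear (λ i → tree i []) b)
        (A.≈ᴹ-trans (eval-cong 𝔸 (λ i → A.≈ᴹ-trans (Linear.cong extend-linear (Θ-tree ψ ψψ i []))
          (eval-single 𝔸 extend (node i []))) b)
        (A.≈ᴹ-sym (linear-free _≡_ 𝔸
          (record { cong = f.cong ; +-homo = f.additive ; *-homo = f.homogeneous }) b)))
      unique : ∀ G → IsMorphism K d φ A G → (∀ b → G (dot K d b) A.≈ᴹ f b) → ∀ x → G x A.≈ᴹ F x
      -- G is `G₀` after Θ_ψ, where `G₀`, being G after Θ_φ, is a morphism for the undeformed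
      -- product, to which uniqueness applies.
      unique G G-morphism G-dot x = A.≈ᴹ-trans (Linear.cong G-linear (lsym (ΘφΘψ x)))
        (Uniqueness.G≈extend G₀ G₀-linear G₀-graft G₀-dot (Θ K d ψ x))
        where
        module G = IsMorphism G-morphism
        module Gₗ = IsLinear G.linear
        G-linear : Linear 𝕋 𝔸 G
        G-linear = record { cong = Gₗ.cong ; +-homo = Gₗ.additive ; *-homo = Gₗ.homogeneous }
        G₀ : Lin K T → A.Carrierᴹ
        G₀ = G ∘ Θ K d φ
        G₀-linear : Linear 𝕋 𝔸 G₀
        G₀-linear = linear-∘ 𝕋 𝕋 𝔸 G-linear φ.Θ-linear
        G₀-graft : ∀ a t s → G₀ (graft K d (idφ K d) a t s) A.≈ᴹ act a (G₀ (single K t)) (G₀ (single K s))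
        G₀-graft a t s = A.≈ᴹ-trans
          (Linear.cong G₀-linear (lsym (ltrans (◁₀.◁≈L (single K t) (single K a) (single K s))
            (ltrans (eval-single 𝕋 (λ a → ◁₀.L a (single K t) (single K s)) a) (◁₀.L-single a t s)))))
          (A.≈ᴹ-trans (Linear.cong G-linear (Θ-morphism φ φφ (single K a) (single K t) (single K s)))
            (G.preserves (single K a) (Θ K d φ (single K t)) (Θ K d φ (single K s))))
        G₀-dot : ∀ b → G₀ (tree b []) A.≈ᴹ f (single K b)
        G₀-dot b = A.≈ᴹ-trans
          (Linear.cong G-linear (ltrans (Θ-tree φ φφ b []) (lsym (eval-single 𝕋 (λ i → tree i []) b))))
          (G-dot (single K b))

-- Application to φ^λ and its inverse

module _ {c ℓ : Level} (K : Field c ℓ) (d : ℕ) where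
  open Field K using (Carrier; _≈_; _+_; 0#; -_; -‿inverseˡ; -‿inverseʳ)
  open Trees K d
  open Gather 𝕋

  opaque
    unfolding Shifts.evalₙ

    -- With `evalₙ` unfolded, `φₙ` at length `suc d` is `φ^` by definition.
    φ^-compatible : ∀ xs ys → Compatible (φ^ K d xs) (φ^ K d ys)
    φ^-compatible xs ys a c b k = Shifts.evalₙ-compatible K d 𝕋 xs ys a c b k

    φ^-inverse : ∀ {xs ys : Vec Carrier (suc d)} → Pointwise (λ x y → x + y ≈ 0#) xs ys →
                 Inverse (φ^ K d xs) (φ^ K d ys)
    φ^-inverse x+y≈0 a b k = Shifts.evalₙ-inverse K d 𝕋 x+y≈0 a b k

  +-negᵥ : ∀ {n} (xs : Vec Carrier n) → Pointwise (λ x y → x + y ≈ 0#) xs (map -_ xs)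
  +-negᵥ []       = []
  +-negᵥ (x ∷ xs) = -‿inverseʳ x ∷ +-negᵥ xs

  negᵥ-+ : ∀ {n} (xs : Vec Carrier n) → Pointwise (λ x y → x + y ≈ 0#) (map -_ xs) xs
  negᵥ-+ []       = []
  negᵥ-+ (x ∷ xs) = -‿inverseˡ x ∷ negᵥ-+ xs

theorem4p6 : {c ℓ m ℓm : Level} (K : Field c ℓ) → CharZero K →
    (d : ℕ) (λ' : Vec (Field.Carrier K) (suc d)) →
    IsMultiplePreLie𝒯 K d (φ^ K d λ') ×
    FreelyGenerated K d m ℓm (φ^ K d λ') ×
    IsIsoWithInverse K d (φ^ K d λ') (φ^ K d (map (Field.-_ K) λ'))
theorem4p6 K _ d λ' = isMultiplePreLie , freelyGenerated , isIsoWithInverse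
  where
  μ = map (Field.-_ K) λ'
  open Transport.MutuallyInverse K d (φ^ K d λ') (φ^ K d μ)
    (φ^-compatible K d λ' λ') (φ^-compatible K d μ μ) (φ^-compatible K d λ' μ) (φ^-compatible K d μ λ')
    (φ^-inverse K d (+-negᵥ K d λ')) (φ^-inverse K d (negᵥ-+ K d λ'))
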